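{- Let $K$ be a local field with finite residue field $k$ of characteristic $p$ and cardinality $q$, let $e>0$ be an integer with $e\not\equiv 0\pmod p$, and let $f>0$ be an integer such that $q^f\equiv 1\pmod e$. Let $K_f$ be the unramified extension of $K$ of degree $f$, $k_f$ its residue field, $G_f=\mathrm{Gal}(K_f|K)$, and let $\mathcal R_e(K_f)^{G_f}$ be the set of $G_f$-stable ramified lines in $K_f^\times/K_f^{\times e}$. Then for every $D\in\mathcal R_e(K_f)^{G_f}$, the canonical isomorphism $$H^2(G_f,k_f^\times/k_f^{\times e})_q\to H^2(G_f,{}_ek_f^\times)_q$$ induced by $\bar\xi\mapsto\xi^{(q^f-1)/e}$ sends the first cohomology class of $D$ to the second cohomology class of $D$ (both defined in the context).
   Context: A local field is a field complete for a discrete valuation with finite residue field. For an abelian group $A$ written multiplicatively, ${}_eA$ is the kernel of $x\mapsto x^e$. Elements of $k_f^\times$ are identified with their Teichmüller lifts in $K_f^\times$. Ramified lines: let $\bar w_f:K_f^\times/K_f^{\times e}\to\mathbf Z/e\mathbf Z$ be induced by the normalised valuation of $K_f$. A ramified line is a subgroup $D\subset K_f^\times/K_f^{\times e}$ on which $\bar w_f$ restricts to an isomorphism $D\to\mathbf Z/e\mathbf Z$. $G_f$ acts naturally on the set of ramified lines. Cohomology: $G_f$ is cyclic with canonical generator $\sigma$ inducing $x\mapsto x^q$ on $k_f$. For a $G_f$-module $C$ on which $\sigma$ acts by $x\mapsto x^q$ (such as $C=k_f^\times/k_f^{\times e}$ or $C={}_ek_f^\times$), $H^2(G_f,C)_q$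 is the kernel of $x\mapsto x^{q-1}$ on $C$ modulo the image of $x\mapsto x^{1+q+\cdots+q^{f-1}}$ on $C$. Classes of $D\in\mathcal R_e(K_f)^{G_f}$: choose a uniformiser $\pi$ of $K$ and $\xi\in k_f^\times$ such that $D$ is generated by the image of $\xi\pi$. The stability of $D$ gives $\bar\xi^{\,q-1}=1$ in $k_f^\times/k_f^{\times e}$. The first class of $D$ is the class of $\bar\xi$ in $H^2(G_f,k_f^\times/k_f^{\times e})_q$. For the second class, write $\xi^{q-1}=\alpha^e$ with $\alpha\in k_f^\times$ and put $\zeta=N_f(\alpha)$, where $N_f:k_f^\times\to k^\times$ is the norm; then $\zeta\in{}_ek_f^\times$ and $\zeta^{q-1}=1$, and the second class of $D$ is the class of $\zeta$ in $H^2(G_f,{}_ek_f^\times)_q$. Neither class depends on the choices made. -}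

module Defs where

open import Algebra.Apartness.Bundles using (HeytingField)
open import Algebra.Bundles using (AbelianGroup; CommutativeRing)
import Algebra.Definitions
import Algebra.Definitions.RawMonoid as RawMonoidOps
open import Algebra.Morphism.Structures
  using (module GroupMorphisms; module RingMorphisms)
import Algebra.Properties.AbelianGroup as AbelianGroupProps
import Algebra.Properties.CommutativeMonoid.Mult as MultProps
import Algebra.Properties.CommutativeMonoid.Sum as SumProps
import Algebra.Properties.CommutativeSemigroup as CSemigroupProps
import Algebra.Properties.Group as GroupProps
import Algebra.Properties.Ring as RingProps
open import Data.Empty using (⊥-elim)
open import Data.Fin.Base using (Fin; zero; suc; toℕ; punchIn; combine; funToFin; finToFun)
import Data.Fin.Properties as Fin
open import Data.Fin.Permutation using (Permutation′; permutation; _⟨$⟩ʳ_)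
open import Data.Integer.Base as ℤ using (ℤ; +_; -[1+_]; 0ℤ; 1ℤ)
import Data.Integer.Properties as ℤ
open import Data.Nat.Base as ℕ using (ℕ; zero; suc; NonZero; _∸_)
open import Data.Nat.Divisibility using (_∣_)
open import Data.Nat.DivMod using (_/_; m*[n/m]≡n)
open import Data.Nat.GeneralisedArithmetic using (iterate)
import Data.Nat.Properties as ℕ
open import Data.Product.Base using (Σ; ∃; _×_; _,_; proj₁; proj₂)
open import Data.Sum.Base using (_⊎_; inj₁; inj₂)
open import Data.Vec.Functional using (Vector; replicate; removeAt)
open import Function.Base using (_∘_; _$_)
open import Function.Bundles using (_⇔_; Inverse)
open import Level using (Level; _⊔_; 0ℓ) renaming (suc to lsuc)
import Relation.Binary.Reasoning.Setoid as SetoidReasoning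
open import Relation.Binary.PropositionalEquality as ≡ using (_≡_; _≢_)
open import Relation.Nullary using (¬_; Dec; yes; no; contradiction)

private variable
  a b c c′ ℓ ℓ′ ℓ₁ ℓ₂ m₁ m₂ m₃ : Level

module Power (A : AbelianGroup a ℓ) where
  open AbelianGroup A
  open MultProps commutativeMonoid
    using (×-congʳ; ×-distrib-+; ×-assocˡ; ×-homo-+)
    renaming (_×_ to _·_)
  open GroupProps group using (inverseˡ-unique)

  infixr 8 _^_ _^ᶻ_

  _^_ : Carrier → ℕ → Carrier
  x ^ n = n · x

  _^ᶻ_ : Carrier → ℤ → Carrier
  x ^ᶻ (+ n)      = x ^ n
  x ^ᶻ (-[1+ n ]) = (x ^ suc n) ⁻¹

  ^-cong : ∀ n {x y} → x ≈ y → x ^ n ≈ y ^ n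
  ^-cong n = ×-congʳ n

  ∙-^ : ∀ n x y → (x ∙ y) ^ n ≈ x ^ n ∙ y ^ n
  ∙-^ n x y = ×-distrib-+ x y n

  ε-^ : ∀ n → ε ^ n ≈ ε
  ε-^ zero    = refl
  ε-^ (suc n) = trans (identityˡ _) (ε-^ n)

  ^-assoc : ∀ x m n → (x ^ m) ^ n ≈ x ^ (n ℕ.* m)
  ^-assoc x m n = ×-assocˡ x n m

  ^-+ : ∀ x m n → x ^ (m ℕ.+ n) ≈ x ^ m ∙ x ^ n
  ^-+ = ×-homo-+

  ⁻¹-^ : ∀ n x → (x ⁻¹) ^ n ≈ (x ^ n) ⁻¹
  ⁻¹-^ n x = inverseˡ-unique _ _ $
    trans (sym (∙-^ n (x ⁻¹) x)) (trans (^-cong n (inverseˡ x)) (ε-^ n))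

record Subgroup (A : AbelianGroup a ℓ) (p : Level) : Set (a ⊔ ℓ ⊔ lsuc p) where
  open AbelianGroup A
  field
    Mem      : Carrier → Set p
    resp     : ∀ {x y} → x ≈ y → Mem x → Mem y
    ε-mem    : Mem ε
    ∙-mem    : ∀ {x y} → Mem x → Mem y → Mem (x ∙ y)
    ⁻¹-mem   : ∀ {x} → Mem x → Mem (x ⁻¹)

subgroup : {A : AbelianGroup a ℓ} {p : Level} → Subgroup A p → AbelianGroup (a ⊔ p) ℓ
subgroup {A = A} H = record
  { Carrier = Σ Carrier Mem
  ; _≈_ = λ x y → proj₁ x ≈ proj₁ y
  ; _∙_ = λ x y → proj₁ x ∙ proj₁ y , ∙-mem (proj₂ x) (proj₂ y)
  ; ε   = ε , ε-mem
  ; _⁻¹ = λ x → proj₁ x ⁻¹ , ⁻¹-mem (proj₂ x)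
  ; isAbelianGroup = record
    { isGroup = record
      { isMonoid = record
        { isSemigroup = record
          { isMagma = record
            { isEquivalence = record { refl = refl ; sym = sym ; trans = trans }
            ; ∙-cong = ∙-cong }
          ; assoc = λ x y z → assoc (proj₁ x) (proj₁ y) (proj₁ z) }
        ; identity = (λ x → identityˡ (proj₁ x)) , (λ x → identityʳ (proj₁ x)) }
      ; inverse = (λ x → inverseˡ (proj₁ x)) , (λ x → inverseʳ (proj₁ x))
      ; ⁻¹-cong = ⁻¹-cong }
    ; comm = λ x y → comm (proj₁ x) (proj₁ y) } }
  where open AbelianGroup A
        open Subgroup H

infixl 7 _⧸_

_⧸_ : (A : AbelianGroup a ℓ) {p : Level} → Subgroup A p → AbelianGroup a p
A ⧸ H = record
  { Carrier = Carrier
  ; _≈_ = λ x y → Mem (x ∙ y ⁻¹)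
  ; _∙_ = _∙_
  ; ε   = ε
  ; _⁻¹ = _⁻¹
  ; isAbelianGroup = record
    { isGroup = record
      { isMonoid = record
        { isSemigroup = record
          { isMagma = record
            { isEquivalence = record
              { refl  = λ {x} → resp (sym (inverseʳ x)) ε-mem
              ; sym   = λ {x} {y} h → resp
                  (⁻¹-anti-homo‿- x y) (⁻¹-mem h)
              ; trans = λ {x} {y} {z} h k → resp (telescope x y z) (∙-mem h k) }
            ; ∙-cong = λ {x} {y} {u} {w} h k → resp
                (trans (interchange _ _ _ _) (∙-congˡ (⁻¹-∙-comm y w))) (∙-mem h k) }
          ; assoc = λ x y z → lift (assoc x y z) }
        ; identity = (λ x → lift (identityˡ x)) , (λ x → lift (identityʳ x)) }
      ; inverse = (λ x → lift (inverseˡ x)) , (λ x → lift (inverseʳ x))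
      ; ⁻¹-cong = λ {x} {y} h → resp (sym (⁻¹-∙-comm x (y ⁻¹))) (⁻¹-mem h) }
    ; comm = λ x y → lift (comm x y) } }
  where
  open AbelianGroup A
  open Subgroup H
  open AbelianGroupProps A using (⁻¹-∙-comm; ⁻¹-anti-homo‿-)
  open CSemigroupProps commutativeSemigroup using (interchange)
  lift : ∀ {x y} → x ≈ y → Mem (x ∙ y ⁻¹)
  lift {x} {y} x≈y = resp (trans (sym (inverseʳ y)) (∙-congʳ (sym x≈y))) ε-mem
  telescope : ∀ x y z → (x ∙ y ⁻¹) ∙ (y ∙ z ⁻¹) ≈ x ∙ z ⁻¹
  telescope x y z = trans (assoc _ _ _) (∙-congˡ
    (trans (sym (assoc _ _ _)) (trans (∙-congʳ (inverseˡ y)) (identityˡ _))))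

powers : (A : AbelianGroup a ℓ) → ℕ → Subgroup A (a ⊔ ℓ)
powers A n = record
  { Mem    = λ x → ∃ λ z → x ≈ z ^ n
  ; resp   = λ x≈y (z , h) → z , trans (sym x≈y) h
  ; ε-mem  = ε , sym (ε-^ n)
  ; ∙-mem  = λ (z , h) (w , k) → z ∙ w , trans (∙-cong h k) (sym (∙-^ n z w))
  ; ⁻¹-mem = λ (z , h) → z ⁻¹ , trans (⁻¹-cong h) (sym (⁻¹-^ n z)) }
  where open AbelianGroup A
        open Power A

torsion : (A : AbelianGroup a ℓ) → ℕ → Subgroup A ℓ
torsion A n = record
  { Mem    = λ x → x ^ n ≈ ε
  ; resp   = λ x≈y h → trans (^-cong n (sym x≈y)) h
  ; ε-mem  = ε-^ n
  ; ∙-mem  = λ h k → trans (∙-^ n _ _) (trans (∙-cong h k) (identityˡ ε))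
  ; ⁻¹-mem = λ h → trans (⁻¹-^ n _) (trans (⁻¹-cong h) ε⁻¹≈ε) }
  where open AbelianGroup A
        open Power A
        open GroupProps group using (ε⁻¹≈ε)

_∩ker_ : {A : AbelianGroup a ℓ} {p r : Level} →
         Subgroup A p → (H : Subgroup A r) → Subgroup (subgroup H) p
P ∩ker H = record
  { Mem = λ x → Mem (proj₁ x) ; resp = resp
  ; ε-mem = ε-mem ; ∙-mem = ∙-mem ; ⁻¹-mem = ⁻¹-mem }
  where open Subgroup P

infixl 7 _/^_
infix  9 _[_]

_/^_ : AbelianGroup a ℓ → ℕ → AbelianGroup a (a ⊔ ℓ)
A /^ n = A ⧸ powers A n

_[_] : AbelianGroup a ℓ → ℕ → AbelianGroup (a ⊔ ℓ) ℓ
A [ n ] = subgroup (torsion A n)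

ℤ/_ℤ : ℕ → AbelianGroup 0ℓ 0ℓ
ℤ/ e ℤ = ℤ.+-0-abelianGroup /^ e

geom : ℕ → ℕ → ℕ
geom q f = SumProps.sum ℕ.+-0-commutativeMonoid {f} (λ i → q ℕ.^ toℕ i)

-- Tate's description of H² of a cyclic group of order f with generator acting
-- as x ↦ x^q: the kernel of σ - 1 modulo the image of 1 + σ + ⋯ + σ^(f-1).
H² : (q f : ℕ) → AbelianGroup a ℓ → AbelianGroup (a ⊔ ℓ) (a ⊔ ℓ)
H² q f C = C [ q ∸ 1 ] ⧸ (powers C (geom q f) ∩ker torsion C (q ∸ 1))

module _ (R : CommutativeRing c ℓ) where
  open CommutativeRing R
  open Algebra.Definitions _≈_ using (Invertible)
  open RawMonoidOps +-rawMonoid using () renaming (_×_ to _·_)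

  IsUnit : Carrier → Set (c ⊔ ℓ)
  IsUnit = Invertible 1# _*_

  private
    mulˡ : ∀ {x y x′ y′} → x′ * x ≈ 1# → y′ * y ≈ 1# → (x′ * y′) * (x * y) ≈ 1#
    mulˡ h k = trans (interchange _ _ _ _) (trans (*-cong h k) (*-identityˡ 1#))
      where open CSemigroupProps *-commutativeSemigroup using (interchange)

  units : AbelianGroup (c ⊔ ℓ) ℓ
  units = record
    { Carrier = Σ Carrier IsUnit
    ; _≈_ = λ x y → proj₁ x ≈ proj₁ y
    ; _∙_ = λ (x , x′ , xl , xr) (y , y′ , yl , yr) →
        x * y , x′ * y′ , mulˡ xl yl , mulˡ xr yr
    ; ε   = 1# , 1# , *-identityˡ 1# , *-identityˡ 1#
    ; _⁻¹ = λ (x , x′ , xl , xr) → x′ , x , xr , xl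
    ; isAbelianGroup = record
      { isGroup = record
        { isMonoid = record
          { isSemigroup = record
            { isMagma = record
              { isEquivalence = record { refl = refl ; sym = sym ; trans = trans }
              ; ∙-cong = *-cong }
            ; assoc = λ x y z → *-assoc _ _ _ }
          ; identity = (λ x → *-identityˡ _) , (λ x → *-identityʳ _) }
        ; inverse = (λ (x , x′ , xl , xr) → xl) , (λ (x , x′ , xl , xr) → xr)
        ; ⁻¹-cong = λ {(x , x′ , xl , xr)} {(y , y′ , yl , yr)} x≈y → begin
            x′            ≈⟨ *-identityʳ x′ ⟨
            x′ * 1#       ≈⟨ *-congˡ yr ⟨
            x′ * (y * y′) ≈⟨ *-assoc x′ y y′ ⟨
            (x′ * y) * y′ ≈⟨ *-congʳ (*-congˡ x≈y) ⟨
            (x′ * x) * y′ ≈⟨ *-congʳ xl ⟩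
            1# * y′       ≈⟨ *-identityˡ y′ ⟩
            y′            ∎ }
      ; comm = λ x y → *-comm _ _ } }
    where open SetoidReasoning setoid

  HasCharacteristic : ℕ → Set ℓ
  HasCharacteristic p = ∀ n → (n · 1# ≈ 0#) ⇔ (p ∣ n)

module _ (R : CommutativeRing c ℓ) (S : CommutativeRing c′ ℓ′) where
  private
    module R = CommutativeRing R
    module S = CommutativeRing S
  open RingMorphisms R.rawRing S.rawRing using (IsRingHomomorphism)
  open RawMonoidOps S.+-rawMonoid using (sum)

  module _ {h : R.Carrier → S.Carrier} (hom : IsRingHomomorphism h) where
    open IsRingHomomorphism hom

    isUnit-map : ∀ {x} → IsUnit R x → IsUnit S (h x)
    isUnit-map (x′ , l , r) =
        h x′
      , S.trans (S.sym (*-homo _ _)) (S.trans (⟦⟧-cong l) 1#-homo)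
      , S.trans (S.sym (*-homo _ _)) (S.trans (⟦⟧-cong r) 1#-homo)

    units-map : AbelianGroup.Carrier (units R) → AbelianGroup.Carrier (units S)
    units-map (x , u) = h x , isUnit-map u

  record IsBasis (h : R.Carrier → S.Carrier) {n : ℕ} (b : Vector S.Carrier n)
         : Set (c ⊔ ℓ ⊔ c′ ⊔ ℓ′) where
    field
      spanning    : ∀ y → ∃ λ (x : Vector R.Carrier n) →
                    sum (λ i → h (x i) S.* b i) S.≈ y
      independent : ∀ (x : Vector R.Carrier n) →
                    sum (λ i → h (x i) S.* b i) S.≈ S.0# → ∀ i → x i R.≈ R.0#

  HasDegree : (h : R.Carrier → S.Carrier) → ℕ → Set (c ⊔ ℓ ⊔ c′ ⊔ ℓ′)
  HasDegree h n = ∃ λ (b : Vector S.Carrier n) → IsBasis h b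

module _ {R : CommutativeRing c ℓ} {S : CommutativeRing c′ ℓ′} where
  private
    module R = CommutativeRing R
    module S = CommutativeRing S
  open RingMorphisms R.rawRing S.rawRing using (IsRingHomomorphism)

  degree-Inverse : ∀ {h n q} → IsRingHomomorphism h → HasDegree R S h n →
                   Inverse R.setoid (≡.setoid (Fin q)) →
                   Inverse S.setoid (≡.setoid (Fin (q ℕ.^ n)))
  degree-Inverse {h} {n} {q} hom (β , basis) I = record
    { to        = enc
    ; from      = dec
    ; to-cong   = λ {y} {z} y≈z → funToFin-cong λ i → I.to-cong
        (unique (coords y) (coords z)
          (S.trans (coords-sum y) (S.trans y≈z (S.sym (coords-sum z)))) i)
    ; from-cong = λ { ≡.refl → S.refl }
    ; inverse   =
        (λ {j} {y} y≈ → ≡.trans (funToFin-cong λ i → ≡.trans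
            (I.to-cong (unique (coords y) (λ i → I.from (finToFun j i))
              (S.trans (coords-sum y) y≈) i))
            (I.strictlyInverseˡ _))
          (Fin.funToFin-finToFin {n} {q} j))
      , (λ { {y} ≡.refl → S.trans
            (lin-cong λ i → R.trans
              (I.from-cong (Fin.finToFun-funToFin {n} {q} (λ i → I.to (coords y i)) i))
              (I.strictlyInverseʳ _))
            (coords-sum y) }) }
    where
    module I = Inverse I
    open IsRingHomomorphism hom
    open SumProps S.+-commutativeMonoid using (sum; sum-cong-≋; ∑-distrib-+)
    open IsBasis basis

    lin : Vector R.Carrier n → S.Carrier
    lin x = sum (λ i → h (x i) S.* β i)

    coords : S.Carrier → Vector R.Carrier n
    coords y = proj₁ (spanning y)
    coords-sum : ∀ y → lin (coords y) S.≈ y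
    coords-sum y = proj₂ (spanning y)

    lin-cong : ∀ {x y} → (∀ i → x i R.≈ y i) → lin x S.≈ lin y
    lin-cong {x} {y} p = sum-cong-≋ {n} {x = λ i → h (x i) S.* β i} {y = λ i → h (y i) S.* β i}
      (λ i → S.*-congʳ (⟦⟧-cong (p i)))

    lin-sub : ∀ x y → lin (λ i → x i R.- y i) S.+ lin y S.≈ lin x
    lin-sub x y = S.trans
      (S.sym (∑-distrib-+ (λ i → h (x i R.- y i) S.* β i) (λ i → h (y i) S.* β i)))
      (sum-cong-≋ {n} {x = λ i → h (x i R.- y i) S.* β i S.+ h (y i) S.* β i}
                      {y = λ i → h (x i) S.* β i}
        λ i → S.trans (S.sym (S.distribʳ (β i) _ _))
        (S.*-congʳ (S.trans (S.sym (+-homo _ _)) (⟦⟧-cong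
          (R.trans (R.+-assoc _ _ _)
            (R.trans (R.+-congˡ (R.-‿inverseˡ _)) (R.+-identityʳ _)))))))

    unique : ∀ x y → lin x S.≈ lin y → ∀ i → x i R.≈ y i
    unique x y p i = x∙y⁻¹≈ε⇒x≈y (x i) (y i) (independent _
      (identityˡ-unique _ (lin y) (S.trans (lin-sub x y) p)) i)
      where
      open GroupProps (AbelianGroup.group R.+-abelianGroup) using (x∙y⁻¹≈ε⇒x≈y)
      open GroupProps (AbelianGroup.group S.+-abelianGroup) using (identityˡ-unique)

    funToFin-cong : ∀ {m n} {g k : Fin m → Fin n} → (∀ i → g i ≡ k i) →
                    funToFin g ≡ funToFin k
    funToFin-cong {zero}  p = ≡.refl
    funToFin-cong {suc m} p = ≡.cong₂ combine (p zero) (funToFin-cong (p ∘ suc))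

    enc : S.Carrier → Fin (q ℕ.^ n)
    enc y = funToFin (λ i → I.to (coords y i))
    dec : Fin (q ℕ.^ n) → S.Carrier
    dec j = lin (λ i → I.from (finToFun j i))

heytingRing : HeytingField c ℓ₁ ℓ₂ → CommutativeRing c ℓ₁
heytingRing F = record { isCommutativeRing = HeytingField.isCommutativeRing F }

record DiscretelyValuedField c ℓ₁ ℓ₂ : Set (lsuc (c ⊔ ℓ₁ ⊔ ℓ₂)) where
  field
    heytingField : HeytingField c ℓ₁ ℓ₂

  open HeytingField heytingField public
    using (_#_; #⇒invertible; invertible⇒#; #-irrefl; tight)

  commutativeRing : CommutativeRing c ℓ₁
  commutativeRing = heytingRing heytingField

  open CommutativeRing commutativeRing public

  Kˣ : AbelianGroup (c ⊔ ℓ₁) ℓ₁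
  Kˣ = units commutativeRing

  open AbelianGroup Kˣ using () renaming (Carrier to Unit; rawGroup to Kˣ-rawGroup)

  field
    v : Unit → ℤ
    v-homo : GroupMorphisms.IsGroupHomomorphism
               Kˣ-rawGroup (AbelianGroup.rawGroup ℤ.+-0-abelianGroup) v
    v-normalised : ∃ λ π → v π ≡ 1ℤ
    v-ultrametric : ∀ x y s → proj₁ s ≈ proj₁ x + proj₁ y → v x ℤ.⊓ v y ℤ.≤ v s

  -- v x ≥ n, with the convention v 0 = ∞
  infix 4 _∈𝔪^_
  _∈𝔪^_ : Carrier → ℤ → Set (c ⊔ ℓ₁)
  x ∈𝔪^ n = ∀ (u : IsUnit commutativeRing x) → n ℤ.≤ v (x , u)

  -- Classically automatic, since x is 0 or a unit.  Equality in K need not be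
  -- decidable, so that for instance the p-adic numbers are not excluded.
  field
    v-located : ∀ x n → (∃ λ (u : IsUnit commutativeRing x) → v (x , u) ℤ.< n) ⊎ (x ∈𝔪^ n)

  private
    module v = GroupMorphisms.IsGroupHomomorphism v-homo
    open SetoidReasoning setoid
    open RingProps ring
      using (-‿distribˡ-*; -‿distribʳ-*; -0#≈0#; -1*x≈-x; -‿involutive; -‿+-comm)

  x-0≈x : ∀ x → x - 0# ≈ x
  x-0≈x x = trans (+-congˡ -0#≈0#) (+-identityʳ x)

  unit-resp : ∀ {x y} → x ≈ y → IsUnit commutativeRing x → IsUnit commutativeRing y
  unit-resp x≈y (x′ , l , r) =
    x′ , trans (*-congˡ (sym x≈y)) l , trans (*-congʳ (sym x≈y)) r

  unit-#0 : ∀ {x} → IsUnit commutativeRing x → x # 0#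
  unit-#0 {x} u = invertible⇒# (unit-resp (sym (x-0≈x x)) u)

  #0-unit : ∀ {x} → x # 0# → IsUnit commutativeRing x
  #0-unit {x} p = unit-resp (x-0≈x x) (#⇒invertible p)

  0-nonunit : ¬ IsUnit commutativeRing 0#
  0-nonunit u = #-irrefl refl (unit-#0 u)

  ¬unit⇒0 : ∀ {x} → ¬ IsUnit commutativeRing x → x ≈ 0#
  ¬unit⇒0 {x} ¬u = proj₁ (tight x 0#) (λ p → ¬u (#0-unit p))

  0or-unit : ∀ x {P : Set} → Dec P → (IsUnit commutativeRing x → P) → (x ≈ 0# → P) → P
  0or-unit x (yes p) f g = p
  0or-unit x (no ¬p) f g = g (¬unit⇒0 (λ u → ¬p (f u)))

  0∈𝔪 : ∀ {n} → 0# ∈𝔪^ n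
  0∈𝔪 u = ⊥-elim (0-nonunit u)

  ∈𝔪-resp : ∀ {x y n} → x ≈ y → x ∈𝔪^ n → y ∈𝔪^ n
  ∈𝔪-resp x≈y h u = ℤ.≤-trans (h (unit-resp (sym x≈y) u)) (ℤ.≤-reflexive (v.⟦⟧-cong x≈y))

  ∈𝔪-mono : ∀ {x m n} → m ℤ.≤ n → x ∈𝔪^ n → x ∈𝔪^ m
  ∈𝔪-mono m≤n h u = ℤ.≤-trans m≤n (h u)

  +-∈𝔪 : ∀ {x y n} → x ∈𝔪^ n → y ∈𝔪^ n → (x + y) ∈𝔪^ n
  +-∈𝔪 {x} {y} {n} hx hy u =
    0or-unit x (n ℤ.≤? v (x + y , u))
      (λ ux → 0or-unit y (n ℤ.≤? _)
        (λ uy → ℤ.≤-trans (ℤ.⊓-glb (hx ux) (hy uy))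
                  (v-ultrametric (x , ux) (y , uy) (x + y , u) refl))
        (λ y≈0 → ∈𝔪-resp (trans (sym (+-identityʳ x)) (+-congˡ (sym y≈0))) hx u))
      (λ x≈0 → ∈𝔪-resp (trans (sym (+-identityˡ y)) (+-congʳ (sym x≈0))) hy u)

  *-∈𝔪 : ∀ {x y m n} → x ∈𝔪^ m → y ∈𝔪^ n → (x * y) ∈𝔪^ (m ℤ.+ n)
  *-∈𝔪 {x} {y} {m} {n} hx hy u =
    0or-unit x ((m ℤ.+ n) ℤ.≤? v (x * y , u))
      (λ ux → 0or-unit y ((m ℤ.+ n) ℤ.≤? _)
        (λ uy → ℤ.≤-trans (ℤ.+-mono-≤ (hx ux) (hy uy))
                  (ℤ.≤-reflexive (≡.trans (≡.sym (v.homo (x , ux) (y , uy)))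
                    (v.⟦⟧-cong refl))))
        (λ y≈0 → ∈𝔪-resp (trans (sym (zeroʳ x)) (*-congˡ (sym y≈0))) 0∈𝔪 u))
      (λ x≈0 → ∈𝔪-resp (trans (sym (zeroˡ y)) (*-congʳ (sym x≈0))) 0∈𝔪 u)

  1∈𝔪⁰ : 1# ∈𝔪^ 0ℤ
  1∈𝔪⁰ u = ℤ.≤-reflexive (≡.sym (≡.trans (v.⟦⟧-cong refl) v.ε-homo))

  private
    v-unit-1 : ∀ {x} (u : IsUnit commutativeRing x) → x * x ≈ 1# → v (x , u) ≡ 0ℤ
    v-unit-1 {x} u h = double (≡.trans (≡.sym (v.homo _ _)) (≡.trans (v.⟦⟧-cong h) v.ε-homo))
      where
      double : ∀ {i} → i ℤ.+ i ≡ 0ℤ → i ≡ 0ℤ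
      double {+ zero}   _  = ≡.refl
      double {+ suc n}  ()
      double { -[1+ n ]} ()

    -1∈𝔪⁰ : (- 1#) ∈𝔪^ 0ℤ
    -1∈𝔪⁰ u = ℤ.≤-reflexive (≡.sym (v-unit-1 u
      (trans (-1*x≈-x (- 1#)) (-‿involutive 1#))))

  -‿∈𝔪 : ∀ {x n} → x ∈𝔪^ n → (- x) ∈𝔪^ n
  -‿∈𝔪 {x} {n} h = ∈𝔪-resp (-1*x≈-x x)
    (∈𝔪-mono (ℤ.≤-reflexive (≡.sym (ℤ.+-identityˡ n))) (*-∈𝔪 -1∈𝔪⁰ h))

  ≈⇒∈𝔪 : ∀ {x y n} → x ≈ y → (x - y) ∈𝔪^ n
  ≈⇒∈𝔪 {x} {y} x≈y = ∈𝔪-resp (trans (sym (-‿inverseʳ y)) (+-congʳ (sym x≈y))) 0∈𝔪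

  residueRing : CommutativeRing (c ⊔ ℓ₁) (c ⊔ ℓ₁)
  residueRing = record
    { Carrier = Σ Carrier (_∈𝔪^ 0ℤ)
    ; _≈_ = λ x y → (proj₁ x - proj₁ y) ∈𝔪^ 1ℤ
    ; _+_ = λ (x , hx) (y , hy) → x + y , +-∈𝔪 hx hy
    ; _*_ = λ (x , hx) (y , hy) → x * y , *-∈𝔪 hx hy
    ; -_  = λ (x , hx) → - x , -‿∈𝔪 hx
    ; 0#  = 0# , 0∈𝔪
    ; 1#  = 1# , 1∈𝔪⁰
    ; isCommutativeRing = record
      { isRing = record
        { +-isAbelianGroup = record
          { isGroup = record
            { isMonoid = record
              { isSemigroup = record
                { isMagma = record
                  { isEquivalence = record
                    { refl = ≈⇒∈𝔪 refl
                    ; sym = λ {(x , _)} {(y , _)} h → ∈𝔪-resp (neg-sub x y) (-‿∈𝔪 h)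
                    ; trans = λ {(x , _)} {(y , _)} {(z , _)} h k →
                        ∈𝔪-resp (telescope x y z) (+-∈𝔪 h k) }
                  ; ∙-cong = λ {(x , _)} {(y , _)} {(z , _)} {(w , _)} h k →
                      ∈𝔪-resp (trans (interchange _ _ _ _) (+-congˡ (-‿+-comm y w)))
                        (+-∈𝔪 h k) }
                ; assoc = λ x y z → ≈⇒∈𝔪 (+-assoc _ _ _) }
              ; identity = (λ x → ≈⇒∈𝔪 (+-identityˡ _)) , (λ x → ≈⇒∈𝔪 (+-identityʳ _)) }
            ; inverse = (λ x → ≈⇒∈𝔪 (-‿inverseˡ _)) , (λ x → ≈⇒∈𝔪 (-‿inverseʳ _))
            ; ⁻¹-cong = λ {(x , _)} {(y , _)} h →
                ∈𝔪-resp (sym (-‿+-comm x (- y))) (-‿∈𝔪 h) }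
          ; comm = λ x y → ≈⇒∈𝔪 (+-comm _ _) }
        ; *-cong = λ {(x , _)} {(y , hy)} {(z , hz)} {(w , _)} h k →
            ∈𝔪-resp (product x y z w) (+-∈𝔪 (*-∈𝔪 h hz) (*-∈𝔪 hy k))
        ; *-assoc = λ x y z → ≈⇒∈𝔪 (*-assoc _ _ _)
        ; *-identity = (λ x → ≈⇒∈𝔪 (*-identityˡ _)) , (λ x → ≈⇒∈𝔪 (*-identityʳ _))
        ; distrib = (λ x y z → ≈⇒∈𝔪 (distribˡ _ _ _)) , (λ x y z → ≈⇒∈𝔪 (distribʳ _ _ _)) }
      ; *-comm = λ x y → ≈⇒∈𝔪 (*-comm _ _) } }
    where
    open CSemigroupProps +-commutativeSemigroup using (interchange)
    open AbelianGroupProps +-abelianGroup using (⁻¹-anti-homo‿-)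
    neg-sub : ∀ x y → - (x - y) ≈ y - x
    neg-sub = ⁻¹-anti-homo‿-
    telescope : ∀ x y z → (x - y) + (y - z) ≈ x - z
    telescope x y z = trans (+-assoc _ _ _) (+-congˡ
      (trans (sym (+-assoc _ _ _)) (trans (+-congʳ (-‿inverseˡ y)) (+-identityˡ _))))
    product : ∀ x y z w → (x - y) * z + y * (z - w) ≈ x * z - y * w
    product x y z w = begin
      (x - y) * z + y * (z - w)
        ≈⟨ +-cong (distribʳ _ _ _) (distribˡ _ _ _) ⟩
      (x * z + (- y) * z) + (y * z + y * (- w))
        ≈⟨ +-cong (+-congˡ (sym (-‿distribˡ-* y z))) (+-congˡ (sym (-‿distribʳ-* y w))) ⟩
      (x * z - y * z) + (y * z - y * w)
        ≈⟨ telescope _ _ _ ⟩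
      x * z - y * w ∎

  module k = CommutativeRing residueRing

  kˣ : AbelianGroup (c ⊔ ℓ₁) (c ⊔ ℓ₁)
  kˣ = units residueRing

  residue-0-or-unit : ∀ x → (x k.≈ k.0#) ⊎ IsUnit residueRing x
  residue-0-or-unit (x , hx) with v-located x 1ℤ
  ... | inj₂ h = inj₁ (∈𝔪-resp (sym (x-0≈x x)) h)
  ... | inj₁ (u@(x′ , l , r) , v<1) =
    inj₂ ((x′ , x′∈) , ≈⇒∈𝔪 l , ≈⇒∈𝔪 r)
    where
    x′∈ : x′ ∈𝔪^ 0ℤ
    x′∈ w = ℤ.≤-trans (ℤ.neg-mono-≤ (ℤ.i<j⇒i≤pred[j] v<1))
      (ℤ.≤-reflexive (≡.trans (≡.sym (v.⁻¹-homo (x , u))) (v.⟦⟧-cong refl)))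

  residue-1≉0 : ¬ (k.1# k.≈ k.0#)
  residue-1≉0 h = ℤ.≤⇒≯ (ℤ.≤-trans (∈𝔪-resp (x-0≈x 1#) h (proj₂ 1ˣ)) (ℤ.≤-reflexive v.ε-homo))
                    (ℤ.+<+ ℕ.z<s)
    where 1ˣ = AbelianGroup.ε Kˣ

  IsCauchy : (ℕ → Carrier) → Set (c ⊔ ℓ₁)
  IsCauchy s = ∀ n → ∃ λ N → ∀ i j → N ℕ.≤ i → N ℕ.≤ j → (s i - s j) ∈𝔪^ n

  _ConvergesTo_ : (ℕ → Carrier) → Carrier → Set (c ⊔ ℓ₁)
  s ConvergesTo x = ∀ n → ∃ λ N → ∀ i → N ℕ.≤ i → (s i - x) ∈𝔪^ n

record LocalField c ℓ₁ ℓ₂ : Set (lsuc (c ⊔ ℓ₁ ⊔ ℓ₂)) where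
  field
    discretelyValuedField : DiscretelyValuedField c ℓ₁ ℓ₂

  open DiscretelyValuedField discretelyValuedField public

  field
    complete : ∀ s → IsCauchy s → ∃ λ x → s ConvergesTo x
    card     : ℕ
    residue-finite : Inverse k.setoid (≡.setoid (Fin card))

  card-nonZero : NonZero card
  card-nonZero = Fin.nonZeroIndex (Inverse.to residue-finite k.0#)

module Fermat (R : CommutativeRing c ℓ)
  (1≉0 : ¬ CommutativeRing._≈_ R (CommutativeRing.1# R) (CommutativeRing.0# R))
  (0-or-unit : ∀ x → CommutativeRing._≈_ R x (CommutativeRing.0# R) ⊎ IsUnit R x)
  where
  open CommutativeRing R using (_≈_; 0#; 1#; _*_)

  private
    module R = CommutativeRing R
    Rˣ = units R
    module Rˣ = AbelianGroup Rˣ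
    open Power Rˣ
    open SumProps Rˣ.commutativeMonoid
      using (sum; sum-permute; sum-remove; sum-cong-≋; ∑-distrib-+; sum-replicate)

  unit-exponent : ∀ {N} → Inverse R.setoid (≡.setoid (Fin N)) →
                  ∀ x → x ^ (N ∸ 1) Rˣ.≈ Rˣ.ε
  unit-exponent {zero}  I x with () ← Inverse.to I 0#
  unit-exponent {suc N} I x@(x₀ , x₀′ , xl , xr) = begin
    x ^ N                       ≈⟨ sum-replicate N {x} ⟨
    sum (replicate N x)         ≈⟨ sum-cong-≋ {x = replicate N x} {y = removeAt factor i₀}
                                     (λ i → R.sym (at-nonzero (punchIn i₀ i) (Fin.punchInᵢ≢i i₀ i))) ⟩
    sum (removeAt factor i₀)    ≈⟨ Rˣ.identityˡ (sum (removeAt factor i₀)) ⟨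
    Rˣ.ε Rˣ.∙ sum (removeAt factor i₀)
                                ≈⟨ R.*-congʳ (R.sym at-zero) ⟩
    factor i₀ Rˣ.∙ sum (removeAt factor i₀)
                                ≈⟨ sum-remove {i = i₀} factor ⟨
    sum factor                  ≈⟨ cancel ⟩
    Rˣ.ε                        ∎
    where
    open Inverse I
    open SetoidReasoning Rˣ.setoid
    i₀ = to 0#

    factor-of : ∀ {y} → (y ≈ 0#) ⊎ IsUnit R y → Rˣ.Carrier
    factor-of (inj₁ _) = Rˣ.ε
    factor-of (inj₂ _) = x
    factor : Fin (suc N) → Rˣ.Carrier
    factor i = factor-of (0-or-unit (from i))

    nonzero-of : ∀ {y} → (y ≈ 0#) ⊎ IsUnit R y → Rˣ.Carrier
    nonzero-of     (inj₁ _) = Rˣ.ε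
    nonzero-of {y} (inj₂ u) = y , u
    g : Fin (suc N) → Rˣ.Carrier
    g i = nonzero-of (0-or-unit (from i))

    0-nonunit : ∀ {y} → y ≈ 0# → ¬ IsUnit R y
    0-nonunit y≈0 (y′ , l , _) = 1≉0
      (R.trans (R.sym l) (R.trans (R.*-congˡ y≈0) (R.zeroʳ y′)))

    from-i₀ : from i₀ ≈ 0#
    from-i₀ = strictlyInverseʳ 0#

    at-zero : factor i₀ Rˣ.≈ Rˣ.ε
    at-zero with 0-or-unit (from i₀)
    ... | inj₁ _ = R.refl
    ... | inj₂ u = contradiction u (0-nonunit from-i₀)

    at-nonzero : ∀ i → i ≢ i₀ → factor i Rˣ.≈ x
    at-nonzero i i≢ with 0-or-unit (from i)
    ... | inj₂ _ = R.refl
    ... | inj₁ h = contradiction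
      (≡.trans (≡.sym (strictlyInverseˡ i)) (to-cong h)) i≢


    mul-inv : ∀ y z → z * y ≈ 1# → ∀ i → to (z * from (to (y * from i))) ≡ i
    mul-inv y z zy i = ≡.trans (to-cong
      (R.trans (R.*-congˡ (strictlyInverseʳ _))
        (R.trans (R.sym (R.*-assoc z y _)) (R.trans (R.*-congʳ zy) (R.*-identityˡ _)))))
      (strictlyInverseˡ i)

    π : Permutation′ (suc N)
    π = permutation (λ i → to (x₀ * from i)) (λ i → to (x₀′ * from i))
          (mul-inv x₀′ x₀ xr) (mul-inv x₀ x₀′ xl)

    g-mul : ∀ i → g (π ⟨$⟩ʳ i) Rˣ.≈ factor i Rˣ.∙ g i
    g-mul i with 0-or-unit (from i) | 0-or-unit (from (π ⟨$⟩ʳ i))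
    ... | inj₁ h | inj₁ _ = R.sym (R.*-identityˡ 1#)
    ... | inj₂ u | inj₂ _ = strictlyInverseʳ _
    ... | inj₁ h | inj₂ w = contradiction w (0-nonunit
          (R.trans (strictlyInverseʳ _) (R.trans (R.*-congˡ h) (R.zeroʳ x₀))))
    ... | inj₂ (u , ul , ur) | inj₁ h = contradiction
          (R.trans (R.sym xl) (R.trans (R.*-congˡ x₀≈0) (R.zeroʳ x₀′))) 1≉0
      where
      x₀≈0 : x₀ ≈ 0#
      x₀≈0 = R.trans (R.sym (R.*-identityʳ x₀)) (R.trans (R.*-congˡ (R.sym ur))
        (R.trans (R.sym (R.*-assoc x₀ _ u))
          (R.trans (R.*-congʳ (R.trans (R.sym (strictlyInverseʳ _)) h)) (R.zeroˡ u))))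

    cancel : sum factor Rˣ.≈ Rˣ.ε
    cancel = GroupProps.identityˡ-unique Rˣ.group (sum factor) (sum g) (begin
      sum factor Rˣ.∙ sum g         ≈⟨ ∑-distrib-+ factor g ⟨
      sum (λ i → factor i Rˣ.∙ g i) ≈⟨ sum-cong-≋ {x = λ i → factor i Rˣ.∙ g i} {y = λ i → g (π ⟨$⟩ʳ i)}
                                         (λ i → R.sym (g-mul i)) ⟩
      sum (λ i → g (π ⟨$⟩ʳ i))      ≈⟨ sum-permute g π ⟨
      sum g                         ∎)

record UnramifiedExtension (K : LocalField a b c) (f : ℕ) a′ b′ c′
       : Set (lsuc (a ⊔ b ⊔ c ⊔ a′ ⊔ b′ ⊔ c′)) where
  private module K = LocalField K
  field
    L : LocalField a′ b′ c′
  private module L = LocalField L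
  field
    ι      : K.Carrier → L.Carrier
    ι-homo : RingMorphisms.IsRingHomomorphism K.rawRing L.rawRing ι

  ιˣ : AbelianGroup.Carrier K.Kˣ → AbelianGroup.Carrier L.Kˣ
  ιˣ = units-map K.commutativeRing L.commutativeRing ι-homo

  field
    -- Both valuations are normalised, so this says that the ramification
    -- index is 1.
    v-extends : ∀ u → L.v (ιˣ u) ≡ K.v u
    degree    : HasDegree K.commutativeRing L.commutativeRing ι f

  private module ι = RingMorphisms.IsRingHomomorphism ι-homo

  ι-∈𝔪 : ∀ {x n} → x K.∈𝔪^ n → ι x L.∈𝔪^ n
  ι-∈𝔪 {x} {n} h u = K.0or-unit x (n ℤ.≤? L.v (ι x , u))
    (λ w → ℤ.≤-trans (h w) (ℤ.≤-reflexive (≡.trans (≡.sym (v-extends (x , w))) 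
      (GroupMorphisms.IsGroupHomomorphism.⟦⟧-cong L.v-homo L.refl))))
    (λ x≈0 → L.∈𝔪-resp (L.trans (L.sym ι.0#-homo) (ι.⟦⟧-cong (K.sym x≈0))) L.0∈𝔪 u)

  ῑ : K.k.Carrier → L.k.Carrier
  ῑ (x , h) = ι x , ι-∈𝔪 h

  field
    residue-degree : HasDegree K.residueRing L.residueRing ῑ f

module _ {K : LocalField a b c} {f : ℕ} (Kf : UnramifiedExtension K f m₁ m₂ m₃) where
  open UnramifiedExtension Kf
  private
    module K = LocalField K
    module L = LocalField L
    q = K.card

  record Galois : Set (a ⊔ m₁ ⊔ m₂) where
    open RingMorphisms L.rawRing L.rawRing using (IsRingIsomorphism)
    field
      to    : L.Carrier → L.Carrier
      iso   : IsRingIsomorphism to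
      fixes : ∀ x → to (ι x) L.≈ ι x

    act : AbelianGroup.Carrier L.Kˣ → AbelianGroup.Carrier L.Kˣ
    act = units-map L.commutativeRing L.commutativeRing
            (RingMorphisms.IsRingMonomorphism.isRingHomomorphism
              (IsRingIsomorphism.isRingMonomorphism iso))

  ῑ-homo : RingMorphisms.IsRingHomomorphism K.k.rawRing L.k.rawRing ῑ
  ῑ-homo = record
    { isSemiringHomomorphism = record
      { isNearSemiringHomomorphism = record
        { +-isMonoidHomomorphism = record
          { isMagmaHomomorphism = record
            { isRelHomomorphism = record
              { cong = λ {(x , _)} {(y , _)} h → L.∈𝔪-resp
                  (L.trans (ι.+-homo x (K.- y)) (L.+-congˡ (ι.-‿homo y))) (ι-∈𝔪 h) }
            ; homo = λ (x , _) (y , _) → L.≈⇒∈𝔪 (ι.+-homo x y) }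
          ; ε-homo = L.≈⇒∈𝔪 ι.0#-homo }
        ; *-homo = λ (x , _) (y , _) → L.≈⇒∈𝔪 (ι.*-homo x y) }
      ; 1#-homo = L.≈⇒∈𝔪 ι.1#-homo }
    ; -‿homo = λ (x , _) → L.≈⇒∈𝔪 (ι.-‿homo x) }
    where module ι = RingMorphisms.IsRingHomomorphism ι-homo

  residue-unit-exponent : ∀ x → let open Power L.kˣ in
    AbelianGroup._≈_ L.kˣ (x ^ (q ℕ.^ f ∸ 1)) (AbelianGroup.ε L.kˣ)
  residue-unit-exponent = Fermat.unit-exponent L.residueRing
    L.residue-1≉0 L.residue-0-or-unit (degree-Inverse ῑ-homo residue-degree K.residue-finite)

⧸-^ : {A : AbelianGroup a ℓ} {p : Level} (H : Subgroup A p) → ∀ x n →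
      Power._^_ (A ⧸ H) x n ≡ Power._^_ A x n
⧸-^ H x zero    = ≡.refl
⧸-^ {A = A} H x (suc n) = ≡.cong (AbelianGroup._∙_ A x) (⧸-^ H x n)

subgroup-^ : {A : AbelianGroup a ℓ} {p : Level} (H : Subgroup A p) → ∀ x n →
             proj₁ (Power._^_ (subgroup H) x n) ≡ Power._^_ A (proj₁ x) n
subgroup-^ H x zero    = ≡.refl
subgroup-^ {A = A} H x (suc n) = ≡.cong (AbelianGroup._∙_ A (proj₁ x)) (subgroup-^ H x n)

geom-suc : ∀ q f → geom q (suc f) ≡ 1 ℕ.+ q ℕ.* geom q f
geom-suc q f = ≡.cong suc (go f (λ i → q ℕ.^ toℕ i))
  where
  open SumProps ℕ.+-0-commutativeMonoid using (sum)
  go : ∀ n (t : Vector ℕ n) → sum (λ i → q ℕ.* t i) ≡ q ℕ.* sum t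
  go zero    t = ≡.sym (ℕ.*-zeroʳ q)
  go (suc n) t = ≡.trans (≡.cong (q ℕ.* t zero ℕ.+_) (go n (t ∘ suc)))
                   (≡.sym (ℕ.*-distribˡ-+ q (t zero) _))

geom-∸1 : ∀ q f .{{_ : NonZero q}} → geom q f ℕ.* (q ∸ 1) ≡ q ℕ.^ f ∸ 1
geom-∸1 q@(suc r) f = ≡.cong (_∸ 1) (1+ f)
  where
  open ≡.≡-Reasoning
  1+ : ∀ f → 1 ℕ.+ geom q f ℕ.* r ≡ q ℕ.^ f
  1+ zero    = ≡.refl
  1+ (suc f) = begin
    1 ℕ.+ geom q (suc f) ℕ.* r             ≡⟨ ≡.cong (λ g → 1 ℕ.+ g ℕ.* r) (geom-suc q f) ⟩
    1 ℕ.+ (r ℕ.+ q ℕ.* geom q f ℕ.* r)     ≡⟨ ≡.cong (q ℕ.+_) (ℕ.*-assoc q (geom q f) r) ⟩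
    q ℕ.+ q ℕ.* (geom q f ℕ.* r)           ≡⟨ ℕ.*-suc q (geom q f ℕ.* r) ⟨
    q ℕ.* (1 ℕ.+ geom q f ℕ.* r)           ≡⟨ ≡.cong (q ℕ.*_) (1+ f) ⟩
    q ℕ.* q ℕ.^ f                          ∎

-- The norm of a cyclic extension of degree f with group generated by the
-- Frobenius σ : x ↦ x^q, namely the product of the conjugates α, σα, …, σ^(f-1)α.
-- It is regarded as an element of the unit group A of the big field.
norm : (A : AbelianGroup a ℓ) (q f : ℕ) → AbelianGroup.Carrier A → AbelianGroup.Carrier A
norm A q f α = SumProps.sum commutativeMonoid {f} (λ i → iterate (_^ q) α (toℕ i))
  where open AbelianGroup A
        open Power A

module _ (A : AbelianGroup a ℓ) (q : ℕ) where
  open AbelianGroup A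
  open Power A
  open SumProps commutativeMonoid using (sum; sum-cong-≋)

  norm≈geom : ∀ f α → norm A q f α ≈ α ^ geom q f
  norm≈geom f α = trans (sum-cong-≋ {f} (λ i → conj (toℕ i) α)) (go f (λ i → q ℕ.^ toℕ i))
    where
    conj : ∀ n α → iterate (_^ q) α n ≈ α ^ (q ℕ.^ n)
    conj zero    α = sym (identityʳ α)
    conj (suc n) α = trans (conj n (α ^ q)) (trans (^-assoc α q (q ℕ.^ n))
      (reflexive (≡.cong (α ^_) (ℕ.*-comm (q ℕ.^ n) q))))
    go : ∀ n (t : Vector ℕ n) → sum (λ i → α ^ t i) ≈
         α ^ SumProps.sum ℕ.+-0-commutativeMonoid t
    go zero    t = refl
    go (suc n) t = trans (∙-congˡ (go n (t ∘ suc))) (sym (^-+ α (t zero) _))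

module Cohomology (A : AbelianGroup a ℓ) (q f e : ℕ) .{{_ : NonZero q}} .{{_ : NonZero e}}
  (e∣ : e ∣ q ℕ.^ f ∸ 1)
  (exponent : ∀ x → AbelianGroup._≈_ A (Power._^_ A x (q ℕ.^ f ∸ 1)) (AbelianGroup.ε A))
  where
  open AbelianGroup A
  open Power A
  open SetoidReasoning setoid

  m : ℕ
  m = (q ℕ.^ f ∸ 1) / e

  private
    power-e : ∀ x → (x ^ m) ^ e ≈ ε
    power-e x = begin
      (x ^ m) ^ e         ≈⟨ ^-assoc x m e ⟩
      x ^ (e ℕ.* m)       ≡⟨ ≡.cong (x ^_) (m*[n/m]≡n e∣) ⟩
      x ^ (q ℕ.^ f ∸ 1)   ≈⟨ exponent x ⟩
      ε                   ∎

    comm-^ : ∀ x i j → (x ^ i) ^ j ≈ (x ^ j) ^ i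
    comm-^ x i j = begin
      (x ^ i) ^ j   ≈⟨ ^-assoc x i j ⟩
      x ^ (j ℕ.* i) ≡⟨ ≡.cong (x ^_) (ℕ.*-comm j i) ⟩
      x ^ (i ℕ.* j) ≈⟨ ^-assoc x j i ⟨
      (x ^ j) ^ i   ∎

  H²-map : AbelianGroup.Carrier (H² q f (A /^ e)) → AbelianGroup.Carrier (H² q f (A [ e ]))
  H²-map (x , z , h) = (x ^ m , power-e x) , (begin
      proj₁ (Power._^_ (A [ e ]) (x ^ m , power-e x) (q ∸ 1))
                          ≡⟨ subgroup-^ (torsion A e) (x ^ m , power-e x) (q ∸ 1) ⟩
      (x ^ m) ^ (q ∸ 1)   ≈⟨ comm-^ x m (q ∸ 1) ⟩
      (x ^ (q ∸ 1)) ^ m   ≈⟨ ^-cong m eth-power ⟩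
      (z ^ e) ^ m         ≈⟨ comm-^ z e m ⟩
      (z ^ m) ^ e         ≈⟨ power-e z ⟩
      ε                   ∎)
    where
    open GroupProps group using (ε⁻¹≈ε)
    eth-power : x ^ (q ∸ 1) ≈ z ^ e
    eth-power = begin
      x ^ (q ∸ 1)                                  ≡⟨ ⧸-^ (powers A e) x (q ∸ 1) ⟨
      Power._^_ (A /^ e) x (q ∸ 1)                 ≈⟨ identityʳ _ ⟨
      Power._^_ (A /^ e) x (q ∸ 1) ∙ ε             ≈⟨ ∙-congˡ ε⁻¹≈ε ⟨
      Power._^_ (A /^ e) x (q ∸ 1) ∙ ε ⁻¹          ≈⟨ h ⟩
      z ^ e                                        ∎

  norm-class : ∀ ξ α → ξ ^ (q ∸ 1) ≈ α ^ e → AbelianGroup.Carrier (H² q f (A [ e ]))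
  norm-class ξ α h = (ζ , ζ^e) , (begin
      proj₁ (Power._^_ (A [ e ]) (ζ , ζ^e) (q ∸ 1))
                                 ≡⟨ subgroup-^ (torsion A e) (ζ , ζ^e) (q ∸ 1) ⟩
      ζ ^ (q ∸ 1)                ≈⟨ ^-cong (q ∸ 1) (norm≈geom A q f α) ⟩
      (α ^ geom q f) ^ (q ∸ 1)   ≈⟨ comm-^ α (geom q f) (q ∸ 1) ⟩
      (α ^ (q ∸ 1)) ^ geom q f   ≈⟨ to-exponent α ⟩
      ε                          ∎)
    where
    ζ = norm A q f α
    to-exponent : ∀ x → (x ^ (q ∸ 1)) ^ geom q f ≈ ε
    to-exponent x = begin
      (x ^ (q ∸ 1)) ^ geom q f     ≈⟨ ^-assoc x (q ∸ 1) (geom q f) ⟩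
      x ^ (geom q f ℕ.* (q ∸ 1))   ≡⟨ ≡.cong (x ^_) (geom-∸1 q f) ⟩
      x ^ (q ℕ.^ f ∸ 1)            ≈⟨ exponent x ⟩
      ε                            ∎
    ζ^e : ζ ^ e ≈ ε
    ζ^e = begin
      ζ ^ e                      ≈⟨ ^-cong e (norm≈geom A q f α) ⟩
      (α ^ geom q f) ^ e         ≈⟨ comm-^ α (geom q f) e ⟩
      (α ^ e) ^ geom q f         ≈⟨ ^-cong (geom q f) h ⟨
      (ξ ^ (q ∸ 1)) ^ geom q f   ≈⟨ to-exponent ξ ⟩
      ε                          ∎

module _ {K : LocalField a b c} {f : ℕ} (Kf : UnramifiedExtension K f m₁ m₂ m₃)
         (e : ℕ) where
  open UnramifiedExtension Kf
  private
    module K = LocalField K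
    module L = LocalField L
    q = K.card

  Lˣ/e : AbelianGroup (m₁ ⊔ m₂) (m₁ ⊔ m₂)
  Lˣ/e = L.Kˣ /^ e

  -- L.v induces a map Lˣ/e → ℤ/e; v-iso is about its restriction to the line.
  record RamifiedLine p : Set (m₁ ⊔ m₂ ⊔ lsuc p) where
    field
      line : Subgroup Lˣ/e p
    open Subgroup line public
    field
      v-iso : GroupMorphisms.IsGroupIsomorphism
                (AbelianGroup.rawGroup (subgroup line))
                (AbelianGroup.rawGroup (ℤ/ e ℤ))
                (λ x → L.v (proj₁ x))

  -- Stability under g and under its inverse together give g D = D.
  GaloisStable : ∀ {p} → RamifiedLine p → Set _
  GaloisStable D = ∀ (g : Galois Kf) {x} → Mem x → Mem (Galois.act g x)
    where open RamifiedLine D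

  -- t is the (q^f-1)-st root of unity lifting ξ.
  IsTeichmüller : AbelianGroup.Carrier L.kˣ → AbelianGroup.Carrier L.Kˣ → Set _
  IsTeichmüller ξ t =
    ((proj₁ t L.- proj₁ (proj₁ ξ)) L.∈𝔪^ 1ℤ) × (t ^ (q ℕ.^ f ∸ 1)) ≈ ε
    where open Power L.Kˣ
          open AbelianGroup L.Kˣ using (_≈_; ε)

  record Presentation {p} (D : RamifiedLine p) : Set (a ⊔ b ⊔ m₁ ⊔ m₂ ⊔ p) where
    open RamifiedLine D
    open AbelianGroup Lˣ/e using (_≈_; _∙_)
    open Power Lˣ/e using (_^ᶻ_)
    field
      π         : AbelianGroup.Carrier K.Kˣ
      π-unif    : K.v π ≡ 1ℤ
      ξ         : AbelianGroup.Carrier L.kˣ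
      ξ̃         : AbelianGroup.Carrier L.Kˣ
      ξ̃-lift    : IsTeichmüller ξ ξ̃
      generates : ∀ x → Mem x ⇔ (∃ λ n → x ≈ (ξ̃ ∙ ιˣ π) ^ᶻ n)

  -- The witness h that ξ̄ is killed by q - 1 exists when D is Galois stable.
  IsFirstClass : ∀ {p} → RamifiedLine p → AbelianGroup.Carrier (H² q f (L.kˣ /^ e)) → Set _
  IsFirstClass D c =
    ∃ λ (P : Presentation D) → ∃ λ h →
      AbelianGroup._≈_ (H² q f (L.kˣ /^ e)) c (Presentation.ξ P , h)

  module _ .{{_ : NonZero e}} (e∣ : e ∣ q ℕ.^ f ∸ 1) where
    open Cohomology L.kˣ q f e {{K.card-nonZero}} e∣ (residue-unit-exponent Kf) public

    IsSecondClass : ∀ {p} → RamifiedLine p → AbelianGroup.Carrier (H² q f (L.kˣ [ e ])) → Set _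
    IsSecondClass D c =
      ∃ λ (P : Presentation D) → ∃ λ α → ∃ λ (h : Presentation.ξ P ^ (q ∸ 1) ≈ α ^ e) →
        AbelianGroup._≈_ (H² q f (L.kˣ [ e ])) c (norm-class (Presentation.ξ P) α h)
      where open AbelianGroup L.kˣ
            open Power L.kˣ

{-# OPTIONS --safe #-}

-- Write N = q^f - 1 = e μ = g (q - 1), where g = 1 + q + ⋯ + q^(f-1). Everything
-- rests on one property of the group k_fˣ of order N: if d n = N, every d-torsion
-- element x is an n-th power. For otherwise T^n - x would have no root in k_fˣ, so
-- the monic polynomial (T^N - 1)/(T^n - x) of degree N - n would have N roots. This
-- gives the bijectivity of ξ ↦ ξ^μ on H². If ξ^(q-1) = α^e, then ξ^μ and N_f(α) = α^g
-- have the same (e / gcd(e, g))-th power, so they differ by the gcd(e, g)-th power of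
-- an e-th root of unity, which by Bézout is a g-th power of such a root. Finally two
-- presentations ξπ and ξ′π′ of a line differ by an e-th power, since the valuation is
-- injective on the line; so ξ′/ξ is, modulo e-th powers, the residue of π/π′, which
-- is (q-1)-torsion and hence a g-th power.

module Submission where

open import Defs
open import Algebra.Bundles using (AbelianGroup; CommutativeRing)
open import Algebra.Morphism.Structures using (module GroupMorphisms; module RingMorphisms)
import Algebra.Properties.CommutativeMonoid.Mult as MultProps
import Algebra.Properties.Group as GroupProps
import Algebra.Properties.Ring as RingProps
import Algebra.Solver.Ring.NaturalCoefficients.Default as SemiringSolver
open import Data.Fin.Base using (Fin; zero; suc; punchIn)
import Data.Fin.Properties as Fin
open import Data.Integer.Base as ℤ using (+_; 0ℤ; 1ℤ)
import Data.Integer.Properties as ℤ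
open import Data.Nat.Base as ℕ using (ℕ; zero; suc; NonZero; _∸_)
open import Data.Nat.Divisibility using (_∣_; divides)
open import Data.Nat.DivMod using (m*[n/m]≡n)
open import Data.Nat.GCD using (gcd; gcd-GCD; gcd[m,n]∣m; gcd[m,n]∣n; gcd[m,n]≢0; module Bézout)
import Data.Nat.Properties as ℕ
open import Data.Nat.Tactic.RingSolver using () renaming (solve-∀ to ℕ-solve-∀)
open import Data.Product.Base using (∃; _×_; _,_; proj₁; proj₂)
open import Data.Sum.Base using (_⊎_; inj₁; inj₂)
open import Data.Vec.Base using (Vec; []; _∷_; _++_; replicate)
open import Function.Base using (_∘_)
open import Function.Bundles using (Equivalence; Inverse)
open import Level using (Level)
open import Relation.Binary.PropositionalEquality as ≡ using (_≡_)
import Relation.Binary.Reasoning.Setoid as SetoidReasoning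
open import Relation.Nullary using (¬_; yes; no; contradiction)

-- Root counting over a finite field, and n-th powers among its units.

module FiniteField {c ℓ : Level} (R : CommutativeRing c ℓ)
  (1≉0 : ¬ CommutativeRing._≈_ R (CommutativeRing.1# R) (CommutativeRing.0# R))
  (0-or-unit : ∀ x → CommutativeRing._≈_ R x (CommutativeRing.0# R) ⊎ IsUnit R x)
  where
  open CommutativeRing R hiding (zero)
  open MultProps *-commutativeMonoid using (×-assocˡ) renaming (_×_ to _·_)
  open GroupProps (AbelianGroup.group +-abelianGroup) using
    (x∙y⁻¹≈ε⇒x≈y; x≈y⇒x∙y⁻¹≈ε; ∙-cancelʳ; ∙-cancelˡ)
  open RingProps ring using ([y-z]x≈yx-zx)
  open SemiringSolver commutativeSemiring using (solve; _:=_; _:+_; _:*_; con)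
  open SetoidReasoning setoid

  private
    Rˣ = units R
    module Rˣ = AbelianGroup Rˣ
    open Power Rˣ using () renaming (_^_ to _^ˣ_)

    infixr 8 _↑_
    _↑_ : Carrier → ℕ → Carrier
    x ↑ n = n · x

  proj₁-^ : ∀ x n → proj₁ (x ^ˣ n) ≡ proj₁ x ↑ n
  proj₁-^ x zero    = ≡.refl
  proj₁-^ x (suc n) = ≡.cong (proj₁ x *_) (proj₁-^ x n)

  -- By `0-or-unit` the nonzero difference s - t is invertible, so it can be cancelled.
  cancel-≉ : ∀ {s t y} → ¬ s ≈ t → s * y ≈ t * y → y ≈ 0#
  cancel-≉ {s} {t} {y} s≉t sy≈ty with 0-or-unit (s - t)
  ... | inj₁ s-t≈0        = contradiction (x∙y⁻¹≈ε⇒x≈y s t s-t≈0) s≉t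
  ... | inj₂ (w , l , _) = begin
    y                   ≈⟨ *-identityˡ y ⟨
    1# * y              ≈⟨ *-congʳ l ⟨
    w * (s - t) * y     ≈⟨ *-assoc w (s - t) y ⟩
    w * ((s - t) * y)   ≈⟨ *-congˡ ([y-z]x≈yx-zx y s t) ⟩
    w * (s * y - t * y) ≈⟨ *-congˡ (x≈y⇒x∙y⁻¹≈ε sy≈ty) ⟩
    w * 0#              ≈⟨ zeroʳ w ⟩
    0#                  ∎

  -- Monic polynomials, given by their non-leading coefficients, the constant
  -- term first.
  eval : ∀ {n} → Vec Carrier n → Carrier → Carrier
  eval []       t = 1#
  eval (c ∷ cs) t = c + t * eval cs t

  -- Division by T - r in Horner's scheme: the coefficients of the quotient are the values at r of
  -- the successive tails.
  quotient : ∀ {n} → Carrier → Vec Carrier (suc n) → Vec Carrier n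
  quotient r (_ ∷ [])         = []
  quotient r (_ ∷ cs@(_ ∷ _)) = eval cs r ∷ quotient r cs

  -- This says that eval cs t - eval cs r is t - r times the value of the
  -- quotient, with the terms moved so that no subtraction occurs.
  eval-quotient : ∀ {n} r (cs : Vec Carrier (suc n)) t →
    eval cs t + r * eval (quotient r cs) t ≈ eval cs r + t * eval (quotient r cs) t
  eval-quotient r (c ∷ [])         t =
    solve 3 (λ c r t → (c :+ t :* con 1) :+ r :* con 1 := (c :+ r :* con 1) :+ t :* con 1)
      refl c r t
  eval-quotient r (c ∷ cs@(_ ∷ _)) t = begin
    (c + t * y) + r * (z + t * w)
      ≈⟨ solve 6 (λ c r t y z w →
           (c :+ t :* y) :+ r :* (z :+ t :* w) := (c :+ r :* z) :+ t :* (y :+ r :* w))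
           refl c r t y z w ⟩
    (c + r * z) + t * (y + r * w) ≈⟨ +-congˡ (*-congˡ (eval-quotient r cs t)) ⟩
    (c + r * z) + t * (z + t * w) ∎
    where
    y = eval cs t
    z = eval cs r
    w = eval (quotient r cs) t

  -- Induction on the degree: after division by T minus the first root, the remaining roots are
  -- roots of the quotient, and a monic polynomial of degree 0 is the constant 1.
  too-many-roots : ∀ {n m} (cs : Vec Carrier n) (root : Fin m → Carrier) →
    (∀ {i j} → root i ≈ root j → i ≡ j) → n ℕ.< m → ¬ (∀ i → eval cs (root i) ≈ 0#)
  too-many-roots []          root inj (ℕ.s≤s _)   vanish = 1≉0 (vanish zero)
  too-many-roots cs@(_ ∷ _)  root inj (ℕ.s≤s n<m) vanish =
    too-many-roots (quotient r cs) (root ∘ suc) (Fin.suc-injective ∘ inj) n<m λ i →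
      cancel-≉ {r} {root (suc i)} (λ h → Fin.0≢1+n (inj h)) (∙-cancelˡ 0# _ _ (begin
        0# + r * q i                        ≈⟨ +-congʳ (vanish (suc i)) ⟨
        eval cs (root (suc i)) + r * q i    ≈⟨ eval-quotient r cs (root (suc i)) ⟩
        eval cs r + root (suc i) * q i      ≈⟨ +-congʳ (vanish zero) ⟩
        0# + root (suc i) * q i             ∎))
    where
    r = root zero
    q = λ i → eval (quotient r cs) (root (suc i))

  eval-shift : ∀ k {n} (cs : Vec Carrier n) t → eval (replicate k 0# ++ cs) t ≈ t ↑ k * eval cs t
  eval-shift zero    cs t = sym (*-identityˡ _)
  eval-shift (suc k) cs t = begin
    0# + t * eval (replicate k 0# ++ cs) t ≈⟨ +-identityˡ _ ⟩
    t * eval (replicate k 0# ++ cs) t      ≈⟨ *-congˡ (eval-shift k cs t) ⟩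
    t * (t ↑ k * eval cs t)                ≈⟨ *-assoc _ _ _ ⟨
    t ↑ suc k * eval cs t                  ∎

  -- The quotient of T^((1+d)(1+n)) - x^(1+d) by T^(1+n) - x.
  cofactor : ∀ n d → Carrier → Vec Carrier (d ℕ.* suc n)
  cofactor n zero    x = []
  cofactor n (suc d) x = (x ↑ suc d ∷ replicate n 0#) ++ cofactor n d x

  -- Induction on d: with s = t^(1+n), each step of `cofactor` multiplies the previous value by s
  -- and adds a power of x as constant term. Keeping the identity free of subtraction makes it
  -- accessible to the semiring solver.
  eval-cofactor : ∀ n d x t → let y = eval (cofactor n d x) t in
    t ↑ suc n * y + x ↑ suc d ≈ x * y + (t ↑ suc n) ↑ suc d
  eval-cofactor n zero    x t =
    solve 2 (λ s x → s :* con 1 :+ x :* con 1 := x :* con 1 :+ s :* con 1) refl (t ↑ suc n) x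
  eval-cofactor n (suc d) x t = begin
    s * z + x * y                       ≈⟨ +-congʳ (*-congˡ z≈) ⟩
    s * (y + s * w) + x * y
      ≈⟨ solve 4 (λ s x y w →
           s :* (y :+ s :* w) :+ x :* y := x :* y :+ s :* (s :* w :+ y))
           refl s x y w ⟩
    x * y + s * (s * w + y)             ≈⟨ +-congˡ (*-congˡ (eval-cofactor n d x t)) ⟩
    x * y + s * (x * w + s ↑ suc d)
      ≈⟨ solve 5 (λ s x y w v →
           x :* y :+ s :* (x :* w :+ v) := x :* (y :+ s :* w) :+ s :* v)
           refl s x y w (s ↑ suc d) ⟩
    x * (y + s * w) + s * s ↑ suc d     ≈⟨ +-congʳ (*-congˡ z≈) ⟨
    x * z + s * s ↑ suc d               ∎
    where
    s = t ↑ suc n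
    y = x ↑ suc d
    w = eval (cofactor n d x) t
    z = eval (cofactor n (suc d) x) t
    z≈ : z ≈ y + s * w
    z≈ = +-congˡ (trans (*-congˡ (eval-shift n (cofactor n d x) t)) (sym (*-assoc t (t ↑ n) w)))

  -- Size 0 leaves no room for 0, and size 1 would identify 0 with 1.
  card∸1≢0 : ∀ {M} → Inverse setoid (≡.setoid (Fin M)) → ¬ M ∸ 1 ≡ 0
  card∸1≢0 {zero}  I _      with () ← Inverse.to I 0#
  card∸1≢0 {suc _} I ≡.refl = 1≉0 (trans (sym (strictlyInverseʳ 1#))
    (trans (from-cong (unique (to 1#) (to 0#))) (strictlyInverseʳ 0#)))
    where
    open Inverse I
    unique : (i j : Fin 1) → i ≡ j
    unique zero zero = ≡.refl

  module _ {N : ℕ} (I : Inverse setoid (≡.setoid (Fin (suc N)))) where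
    open Inverse I

    private
      nonzero : Fin N → Carrier
      nonzero j = from (punchIn (to 0#) j)

      nonzero-injective : ∀ {i j} → nonzero i ≈ nonzero j → i ≡ j
      nonzero-injective h = Fin.punchIn-injective (to 0#) _ _
        (≡.trans (≡.sym (strictlyInverseˡ _)) (≡.trans (to-cong h) (strictlyInverseˡ _)))

      nonzero-unit : ∀ j → IsUnit R (nonzero j)
      nonzero-unit j with 0-or-unit (nonzero j)
      ... | inj₂ u = u
      ... | inj₁ h = contradiction
        (≡.trans (≡.sym (strictlyInverseˡ _)) (to-cong h)) (Fin.punchInᵢ≢i (to 0#) j)

      unit-of : Fin N → Rˣ.Carrier
      unit-of j = nonzero j , nonzero-unit j

    -- If x is not an n-th power then T^n - x has no root among the N units,
    -- which therefore are all roots of its cofactor in T^N - 1.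
    torsion⇒power-suc : ∀ d n → d ℕ.* n ≡ N → ∀ x → x ^ˣ d Rˣ.≈ Rˣ.ε → ∃ λ u → x Rˣ.≈ u ^ˣ n
    -- A zero factor would force N = 0, whereas the field has at least two elements.
    torsion⇒power-suc zero    n       eq     x h = contradiction (≡.sym eq) (card∸1≢0 I)
    torsion⇒power-suc (suc d) zero    eq     x h = contradiction (≡.trans (≡.sym eq) (ℕ.*-zeroʳ d)) (card∸1≢0 I)
    torsion⇒power-suc (suc d) (suc n) ≡.refl x h
      -- The n-th root is sought by comparing codes in `Fin`, where equality is decidable.
      with Fin.any? (λ j → to (proj₁ (unit-of j ^ˣ suc n)) Fin.≟ to (proj₁ x))
    ... | yes (j , p) = unit-of j ,
      trans (sym (strictlyInverseʳ _)) (trans (from-cong (≡.sym p)) (strictlyInverseʳ _))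
    ... | no  none = contradiction vanish
      -- The cofactor has degree d (1+n), which is less than N = (1+n) + d (1+n).
      (too-many-roots (cofactor n d (proj₁ x)) nonzero nonzero-injective (ℕ.m<n+m _ ℕ.z<s))
      where
      exponent : ∀ y → y ^ˣ (suc d ℕ.* suc n) Rˣ.≈ Rˣ.ε
      exponent = Fermat.unit-exponent R 1≉0 0-or-unit I
      x^≈1 : proj₁ x ↑ suc d ≈ 1#
      x^≈1 = trans (reflexive (≡.sym (proj₁-^ x (suc d)))) h
      t^≈1 : ∀ j → (nonzero j ↑ suc n) ↑ suc d ≈ 1#
      t^≈1 j = begin
        (nonzero j ↑ suc n) ↑ suc d            ≈⟨ ×-assocˡ (nonzero j) (suc d) (suc n) ⟩
        nonzero j ↑ (suc d ℕ.* suc n)          ≡⟨ proj₁-^ (unit-of j) (suc d ℕ.* suc n) ⟨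
        proj₁ (unit-of j ^ˣ (suc d ℕ.* suc n)) ≈⟨ exponent (unit-of j) ⟩
        1#                                     ∎
      not-root : ∀ j → ¬ nonzero j ↑ suc n ≈ proj₁ x
      not-root j z = none (j , to-cong (trans (reflexive (proj₁-^ (unit-of j) (suc n))) z))
      vanish : ∀ j → eval (cofactor n d (proj₁ x)) (nonzero j) ≈ 0#
      vanish j = cancel-≉ (not-root j) (∙-cancelʳ 1# _ _ (begin
        t ↑ suc n * y + 1#                  ≈⟨ +-congˡ x^≈1 ⟨
        t ↑ suc n * y + proj₁ x ↑ suc d     ≈⟨ eval-cofactor n d (proj₁ x) t ⟩
        proj₁ x * y + (t ↑ suc n) ↑ suc d   ≈⟨ +-congˡ (t^≈1 j) ⟩
        proj₁ x * y + 1#                    ∎))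
        where
        t = nonzero j
        y = eval (cofactor n d (proj₁ x)) t

  torsion⇒power : ∀ {M} → Inverse setoid (≡.setoid (Fin M)) → ∀ d n → d ℕ.* n ≡ M ∸ 1 →
                  ∀ x → x ^ˣ d Rˣ.≈ Rˣ.ε → ∃ λ u → x Rˣ.≈ u ^ˣ n
  torsion⇒power {zero}  I with () ← Inverse.to I 0#
  torsion⇒power {suc _} I = torsion⇒power-suc I

-- Exponents, quotients and greatest common divisors in an abelian group.

module _ {a ℓ : Level} (A : AbelianGroup a ℓ) where
  open AbelianGroup A
  open Power A
  open GroupProps group using (inverseˡ-unique; //-rightDividesˡ; //-rightDividesʳ)
  open SetoidReasoning setoid

  ^-comm : ∀ x i j → (x ^ i) ^ j ≈ (x ^ j) ^ i
  ^-comm x i j = begin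
    (x ^ i) ^ j   ≈⟨ ^-assoc x i j ⟩
    x ^ (j ℕ.* i) ≡⟨ ≡.cong (x ^_) (ℕ.*-comm j i) ⟩
    x ^ (i ℕ.* j) ≈⟨ ^-assoc x j i ⟨
    (x ^ j) ^ i   ∎

  ^-annihilated : ∀ {x} n k → x ^ n ≈ ε → (x ^ k) ^ n ≈ ε
  ^-annihilated {x} n k h = trans (^-comm x k n) (trans (^-cong k h) (ε-^ k))

  divide : ∀ {x y z} → x ≈ z ∙ y → x ∙ y ⁻¹ ≈ z
  divide {y = y} h = trans (∙-congʳ h) (//-rightDividesʳ y _)

  undivide : ∀ {x y z} → x ∙ y ⁻¹ ≈ z → x ≈ z ∙ y
  undivide {x} {y} h = trans (sym (//-rightDividesˡ y x)) (∙-congʳ h)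

  -- Meant for two generators ξ̃′π′ and ξ̃π of a ramified line with quotient x: it isolates ξ̃′.
  cross-divide : ∀ {s p′ t p x} → (s ∙ p′) ∙ (t ∙ p) ⁻¹ ≈ x → s ≈ ((p ∙ p′ ⁻¹) ∙ x) ∙ t
  cross-divide {s} {p′} {t} {p} {x} h = begin
    s                         ≈⟨ //-rightDividesʳ p′ s ⟨
    (s ∙ p′) ∙ p′ ⁻¹          ≈⟨ ∙-congʳ (trans (undivide h) (sym (assoc x t p))) ⟩
    ((x ∙ t) ∙ p) ∙ p′ ⁻¹     ≈⟨ assoc (x ∙ t) p (p′ ⁻¹) ⟩
    (x ∙ t) ∙ (p ∙ p′ ⁻¹)     ≈⟨ comm _ _ ⟩
    (p ∙ p′ ⁻¹) ∙ (x ∙ t)     ≈⟨ assoc _ x t ⟨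
    ((p ∙ p′ ⁻¹) ∙ x) ∙ t     ∎

  -- By Bézout the gcd is a multiple of g modulo n, and exponents of x count only modulo n. Over the
  -- naturals the multiplier may have either sign; the first case is the negative one, whence the
  -- inverse.
  torsion-gcd-power : ∀ {x} n g → x ^ n ≈ ε → ∃ λ z → z ^ n ≈ ε × x ^ gcd n g ≈ z ^ g
  torsion-gcd-power {x} n g h with Bézout.identity (gcd-GCD n g)
  ... | Bézout.+- i j eq = (x ^ j) ⁻¹ , Subgroup.⁻¹-mem (torsion A n) (^-annihilated n j h) ,
    trans (inverseˡ-unique _ _ (begin
      x ^ gcd n g ∙ (x ^ j) ^ g     ≈⟨ ∙-congˡ (trans (^-comm x j g) (^-assoc x g j)) ⟩
      x ^ gcd n g ∙ x ^ (j ℕ.* g)   ≈⟨ ^-+ x (gcd n g) (j ℕ.* g) ⟨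
      x ^ (gcd n g ℕ.+ j ℕ.* g)     ≡⟨ ≡.cong (x ^_) eq ⟩
      x ^ (i ℕ.* n)                 ≈⟨ ^-assoc x n i ⟨
      (x ^ n) ^ i                   ≈⟨ trans (^-cong i h) (ε-^ i) ⟩
      ε                             ∎)) (sym (⁻¹-^ g (x ^ j)))
  ... | Bézout.-+ i j eq = x ^ j , ^-annihilated n j h , (begin
      x ^ gcd n g                   ≈⟨ identityʳ _ ⟨
      x ^ gcd n g ∙ ε               ≈⟨ ∙-congˡ (trans (^-cong i h) (ε-^ i)) ⟨
      x ^ gcd n g ∙ (x ^ n) ^ i     ≈⟨ ∙-congˡ (^-assoc x n i) ⟩
      x ^ gcd n g ∙ x ^ (i ℕ.* n)   ≈⟨ ^-+ x (gcd n g) (i ℕ.* n) ⟨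
      x ^ (gcd n g ℕ.+ i ℕ.* n)     ≡⟨ ≡.cong (x ^_) eq ⟩
      x ^ (j ℕ.* g)                 ≈⟨ trans (^-comm x j g) (^-assoc x g j) ⟨
      (x ^ j) ^ g                   ∎)

cancel-common : ∀ {e g m n} e′ g′ d .{{_ : NonZero d}} → e ≡ e′ ℕ.* d → g ≡ g′ ℕ.* d →
  e ℕ.* m ≡ g ℕ.* n → e′ ℕ.* m ≡ g′ ℕ.* n
cancel-common {m = m} {n} e′ g′ d ≡.refl ≡.refl em≡gn = ℕ.*-cancelʳ-≡ _ _ d (begin
  e′ ℕ.* m ℕ.* d ≡⟨ swap e′ m d ⟩
  e′ ℕ.* d ℕ.* m ≡⟨ em≡gn ⟩
  g′ ℕ.* d ℕ.* n ≡⟨ swap g′ d n ⟩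
  g′ ℕ.* n ℕ.* d ∎)
  where
  open ≡.≡-Reasoning
  swap : ∀ a b c → a ℕ.* b ℕ.* c ≡ a ℕ.* c ℕ.* b
  swap = ℕ-solve-∀

-- The map on second cohomology, for an abelian group with the torsion property.

module CyclicCohomology {a ℓ : Level} (A : AbelianGroup a ℓ)
  (q f e : ℕ) .{{_ : NonZero q}} .{{_ : NonZero e}} (e∣ : e ∣ q ℕ.^ f ∸ 1)
  (exponent : ∀ x → AbelianGroup._≈_ A (Power._^_ A x (q ℕ.^ f ∸ 1)) (AbelianGroup.ε A))
  (torsion⇒power : ∀ d n → d ℕ.* n ≡ q ℕ.^ f ∸ 1 → ∀ x →
     AbelianGroup._≈_ A (Power._^_ A x d) (AbelianGroup.ε A) →
     ∃ λ u → AbelianGroup._≈_ A x (Power._^_ A u n))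
  where
  open AbelianGroup A
  open Power A
  open Cohomology A q f e e∣ exponent using ()
    renaming (m to μ; H²-map to φ; norm-class to ζ-class)
  open GroupProps group using (ε⁻¹≈ε)
  open SetoidReasoning setoid

  private
    N = q ℕ.^ f ∸ 1
    g = geom q f
    H²₁ = H² q f (A /^ e)
    H²₂ = H² q f (A [ e ])
    module H²₁ = AbelianGroup H²₁
    module H²₂ = AbelianGroup H²₂

    eμ≡N : e ℕ.* μ ≡ N
    eμ≡N = m*[n/m]≡n e∣

    μe≡N : μ ℕ.* e ≡ N
    μe≡N = ≡.trans (ℕ.*-comm μ e) eμ≡N

  annihilate : ∀ i j → j ℕ.* i ≡ N → ∀ x → (x ^ i) ^ j ≈ ε
  annihilate i j ji≡N x = trans (^-assoc x i j) (trans (reflexive (≡.cong (x ^_) ji≡N)) (exponent x))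

  H²₁-class : ∀ x w → x ^ (q ∸ 1) ≈ w ^ e → H²₁.Carrier
  H²₁-class x w h = x , w , (begin
    Power._^_ (A /^ e) x (q ∸ 1) ∙ ε ⁻¹ ≈⟨ trans (∙-congˡ ε⁻¹≈ε) (identityʳ _) ⟩
    Power._^_ (A /^ e) x (q ∸ 1)        ≡⟨ ⧸-^ (powers A e) x (q ∸ 1) ⟩
    x ^ (q ∸ 1)                         ≈⟨ h ⟩
    w ^ e                               ∎)

  -- Equality in `H²₁` is a quotient of a quotient, taken modulo both g-th and e-th powers. This
  -- lemma and the next translate it to and from a single equation in A.
  H²₁-intro : ∀ c c′ z w → proj₁ c ≈ (z ^ g ∙ w ^ e) ∙ proj₁ c′ → c H²₁.≈ c′
  H²₁-intro c c′ z w h = z , w , (begin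
    (proj₁ c ∙ proj₁ c′ ⁻¹) ∙ (Power._^_ (A /^ e) z g) ⁻¹
                                  ≡⟨ ≡.cong (λ t → (proj₁ c ∙ proj₁ c′ ⁻¹) ∙ t ⁻¹) (⧸-^ (powers A e) z g) ⟩
    (proj₁ c ∙ proj₁ c′ ⁻¹) ∙ (z ^ g) ⁻¹
                                  ≈⟨ divide A (trans (divide A h) (comm _ _)) ⟩
    w ^ e                         ∎)

  H²₁-elim : ∀ {c c′} → c H²₁.≈ c′ → ∃ λ z → ∃ λ w → proj₁ c ≈ (z ^ g ∙ w ^ e) ∙ proj₁ c′
  H²₁-elim {c} {c′} (z , w , h) = z , w , undivide A (trans (undivide A (begin
    (proj₁ c ∙ proj₁ c′ ⁻¹) ∙ (z ^ g) ⁻¹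
                                  ≡⟨ ≡.cong (λ t → (proj₁ c ∙ proj₁ c′ ⁻¹) ∙ t ⁻¹) (⧸-^ (powers A e) z g) ⟨
    (proj₁ c ∙ proj₁ c′ ⁻¹) ∙ (Power._^_ (A /^ e) z g) ⁻¹
                                  ≈⟨ h ⟩
    w ^ e                         ∎)) (comm _ _))

  -- In contrast to `H²₁`, only g-th powers of e-th roots of unity are divided out.
  H²₂-intro : ∀ c c′ z → z ^ e ≈ ε → proj₁ (proj₁ c) ≈ z ^ g ∙ proj₁ (proj₁ c′) → c H²₂.≈ c′
  H²₂-intro c c′ z z^e≈ε h = (z , z^e≈ε) ,
    trans (divide A h) (reflexive (≡.sym (subgroup-^ (torsion A e) (z , z^e≈ε) g)))

  H²₂-elim : ∀ {c c′} → c H²₂.≈ c′ →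
    ∃ λ z → z ^ e ≈ ε × proj₁ (proj₁ c) ≈ z ^ g ∙ proj₁ (proj₁ c′)
  H²₂-elim (z , h) = proj₁ z , proj₂ z ,
    undivide A (trans h (reflexive (subgroup-^ (torsion A e) z g)))

  H²₂-reflexive : ∀ c c′ → proj₁ (proj₁ c) ≈ proj₁ (proj₁ c′) → c H²₂.≈ c′
  H²₂-reflexive c c′ h = H²₂-intro c c′ ε (ε-^ e) (trans h (sym (trans (∙-congʳ (ε-^ g)) (identityˡ _))))

  -- Since e μ = N, raising to the power μ kills e-th powers and turns z into an e-th root of unity.
  φ-cong : ∀ {c c′} → c H²₁.≈ c′ → φ c H²₂.≈ φ c′
  φ-cong {c} {c′} h with z , w , eq ← H²₁-elim {c} {c′} h =
    H²₂-intro (φ c) (φ c′) (z ^ μ) (annihilate μ e eμ≡N z) (begin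
      proj₁ c ^ μ                                ≈⟨ ^-cong μ eq ⟩
      ((z ^ g ∙ w ^ e) ∙ proj₁ c′) ^ μ           ≈⟨ ∙-^ μ _ _ ⟩
      (z ^ g ∙ w ^ e) ^ μ ∙ proj₁ c′ ^ μ         ≈⟨ ∙-congʳ (∙-^ μ _ _) ⟩
      ((z ^ g) ^ μ ∙ (w ^ e) ^ μ) ∙ proj₁ c′ ^ μ ≈⟨ ∙-congʳ (∙-cong (^-comm A z g μ) (annihilate e μ μe≡N w)) ⟩
      ((z ^ μ) ^ g ∙ ε) ∙ proj₁ c′ ^ μ           ≈⟨ ∙-congʳ (identityʳ _) ⟩
      (z ^ μ) ^ g ∙ proj₁ c′ ^ μ                 ∎)

  -- If x^μ = z^g y^μ with z^e = 1, then z = u^μ by the torsion property. So x / (u^g y) is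
  -- μ-torsion, and hence an e-th power.
  φ-injective : ∀ {c c′} → φ c H²₂.≈ φ c′ → c H²₁.≈ c′
  φ-injective {c@(x , _)} {c′@(y , _)} h =
    H²₁-intro c c′ u w (trans (undivide A r≈w^e) (trans (sym (assoc _ _ _)) (∙-congʳ (comm _ _))))
    where
    z = proj₁ (H²₂-elim {φ c} {φ c′} h)
    z^e≈ε = proj₁ (proj₂ (H²₂-elim {φ c} {φ c′} h))
    x^μ≈ = proj₂ (proj₂ (H²₂-elim {φ c} {φ c′} h))
    u = proj₁ (torsion⇒power e μ eμ≡N z z^e≈ε)
    z≈u^μ = proj₂ (torsion⇒power e μ eμ≡N z z^e≈ε)
    r = x ∙ (u ^ g ∙ y) ⁻¹
    r^μ≈ε : r ^ μ ≈ ε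
    r^μ≈ε = begin
      r ^ μ                               ≈⟨ trans (∙-^ μ _ _) (∙-congˡ (⁻¹-^ μ _)) ⟩
      x ^ μ ∙ ((u ^ g ∙ y) ^ μ) ⁻¹        ≈⟨ divide A (begin
        x ^ μ                               ≈⟨ x^μ≈ ⟩
        z ^ g ∙ y ^ μ                       ≈⟨ ∙-congʳ (trans (^-cong g z≈u^μ) (^-comm A u μ g)) ⟩
        (u ^ g) ^ μ ∙ y ^ μ                 ≈⟨ ∙-^ μ _ _ ⟨
        (u ^ g ∙ y) ^ μ                     ≈⟨ identityˡ _ ⟨
        ε ∙ (u ^ g ∙ y) ^ μ                 ∎) ⟩
      ε                                   ∎
    w = proj₁ (torsion⇒power μ e μe≡N r r^μ≈ε)
    r≈w^e = proj₂ (torsion⇒power μ e μe≡N r r^μ≈ε)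

  -- The torsion property is used twice: it writes z as x^μ, and then, because z^(q-1) = 1 makes
  -- x^(q-1) μ-torsion, it writes x^(q-1) as an e-th power.
  φ-surjective : ∀ c → ∃ λ c′ → ∀ {d} → d H²₁.≈ c′ → φ d H²₂.≈ c
  φ-surjective c@((z , z^e≈ε) , killed)
    with x , z≈x^μ ← torsion⇒power e μ eμ≡N z z^e≈ε
    with w , x^≈w^e ← torsion⇒power μ e μe≡N (x ^ (q ∸ 1)) (begin
      (x ^ (q ∸ 1)) ^ μ   ≈⟨ ^-comm A x (q ∸ 1) μ ⟩
      (x ^ μ) ^ (q ∸ 1)   ≈⟨ ^-cong (q ∸ 1) z≈x^μ ⟨
      z ^ (q ∸ 1)         ≡⟨ subgroup-^ (torsion A e) (z , z^e≈ε) (q ∸ 1) ⟨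
      proj₁ (Power._^_ (A [ e ]) (z , z^e≈ε) (q ∸ 1)) ≈⟨ killed ⟩
      ε                   ∎)
    = c′ , λ {d} d≈c′ → H²₂.trans {φ d} {φ c′} {c} (φ-cong {d} {c′} d≈c′)
        (H²₂-reflexive (φ c′) c (sym z≈x^μ))
    where
    c′ = H²₁-class x w x^≈w^e

  φ-homo : ∀ c c′ → φ (c H²₁.∙ c′) H²₂.≈ φ c H²₂.∙ φ c′
  φ-homo c c′ = H²₂-reflexive (φ (c H²₁.∙ c′)) (φ c H²₂.∙ φ c′) (∙-^ μ (proj₁ c) (proj₁ c′))

  φ-ε : φ H²₁.ε H²₂.≈ H²₂.ε
  φ-ε = H²₂-reflexive (φ H²₁.ε) H²₂.ε (ε-^ μ)

  φ-⁻¹ : ∀ c → φ (c H²₁.⁻¹) H²₂.≈ φ c H²₂.⁻¹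
  φ-⁻¹ c = H²₂-reflexive (φ (c H²₁.⁻¹)) (φ c H²₂.⁻¹) (⁻¹-^ μ (proj₁ c))

  -- Both ξ ^ μ and α ^ g have the same (e / gcd e g)-th power, so their quotient
  -- is a (gcd e g)-th power of an e-th root of unity, hence by Bézout a g-th power.
  φ≈ζ-class : ∀ c α (h : proj₁ c ^ (q ∸ 1) ≈ α ^ e) → φ c H²₂.≈ ζ-class (proj₁ c) α h
  φ≈ζ-class c@(ξ , _) α h
    with divides e′ e≡ ← gcd[m,n]∣m e g
    with divides g′ g≡ ← gcd[m,n]∣n e g
    = H²₂-intro (φ c) (ζ-class ξ α h) z z^e≈ε (begin
      ξ ^ μ               ≈⟨ undivide A w≈z^g ⟩
      z ^ g ∙ α ^ g       ≈⟨ ∙-congˡ (norm≈geom A q f α) ⟨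
      z ^ g ∙ norm A q f α ∎)
    where
    d = gcd e g
    instance
      d≢0 : NonZero d
      d≢0 = ℕ.≢-nonZero (gcd[m,n]≢0 e g (inj₁ (ℕ.≢-nonZero⁻¹ e)))

    e′μd≡N : e′ ℕ.* (μ ℕ.* d) ≡ N
    e′μd≡N = ≡.trans (swap e′ μ d) (≡.trans (≡.cong (ℕ._* μ) (≡.sym e≡)) eμ≡N)
      where
      swap : ∀ a b c → a ℕ.* (b ℕ.* c) ≡ a ℕ.* c ℕ.* b
      swap = ℕ-solve-∀

    -- Both sides are N / d, as e μ = N = g (q - 1).
    e′μ≡g′q-1 : e′ ℕ.* μ ≡ g′ ℕ.* (q ∸ 1)
    e′μ≡g′q-1 = cancel-common e′ g′ d e≡ g≡ (≡.trans eμ≡N (≡.sym (geom-∸1 q f)))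

    e′g≡g′e : e′ ℕ.* g ≡ g′ ℕ.* e
    e′g≡g′e = ≡.trans (≡.cong (e′ ℕ.*_) g≡)
      (≡.trans (swap e′ g′ d) (≡.cong (g′ ℕ.*_) (≡.sym e≡)))
      where
      swap : ∀ a b c → a ℕ.* (b ℕ.* c) ≡ b ℕ.* (a ℕ.* c)
      swap = ℕ-solve-∀

    w = ξ ^ μ ∙ (α ^ g) ⁻¹

    w^e′≈ε : w ^ e′ ≈ ε
    w^e′≈ε = begin
      w ^ e′                              ≈⟨ trans (∙-^ e′ _ _) (∙-congˡ (⁻¹-^ e′ _)) ⟩
      (ξ ^ μ) ^ e′ ∙ ((α ^ g) ^ e′) ⁻¹    ≈⟨ divide A (trans same (sym (identityˡ _))) ⟩
      ε                                   ∎
      where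
      same : (ξ ^ μ) ^ e′ ≈ (α ^ g) ^ e′
      same = begin
        (ξ ^ μ) ^ e′                 ≈⟨ ^-assoc ξ μ e′ ⟩
        ξ ^ (e′ ℕ.* μ)               ≡⟨ ≡.cong (ξ ^_) e′μ≡g′q-1 ⟩
        ξ ^ (g′ ℕ.* (q ∸ 1))         ≈⟨ ^-assoc ξ (q ∸ 1) g′ ⟨
        (ξ ^ (q ∸ 1)) ^ g′           ≈⟨ ^-cong g′ h ⟩
        (α ^ e) ^ g′                 ≈⟨ ^-assoc α e g′ ⟩
        α ^ (g′ ℕ.* e)               ≡⟨ ≡.cong (α ^_) e′g≡g′e ⟨
        α ^ (e′ ℕ.* g)               ≈⟨ ^-assoc α g e′ ⟨
        (α ^ g) ^ e′                 ∎

    -- From e′ (μ d) = N it follows that w = (u^μ)^d, where u^μ is an e-th root of unity.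
    root = torsion⇒power e′ (μ ℕ.* d) e′μd≡N w w^e′≈ε
    u = proj₁ root
    bezout = torsion-gcd-power A e g (annihilate μ e eμ≡N u)
    z = proj₁ bezout
    z^e≈ε = proj₁ (proj₂ bezout)

    w≈z^g : w ≈ z ^ g
    w≈z^g = begin
      w                   ≈⟨ proj₂ root ⟩
      u ^ (μ ℕ.* d)       ≡⟨ ≡.cong (u ^_) (ℕ.*-comm μ d) ⟩
      u ^ (d ℕ.* μ)       ≈⟨ ^-assoc u μ d ⟨
      (u ^ μ) ^ d         ≈⟨ proj₂ (proj₂ bezout) ⟩
      z ^ g               ∎

  -- The two classes may come from different presentations. Since ξ and d agree in `H²₁`, the first
  -- class can be represented by the same ξ that defines the second.
  φ-first≈second : ∀ c₁ c₂ d ξ α (h : ξ ^ (q ∸ 1) ≈ α ^ e) → c₁ H²₁.≈ d →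
    (∃ λ z → ∃ λ w → ξ ≈ (z ^ g ∙ w ^ e) ∙ proj₁ d) → c₂ H²₂.≈ ζ-class ξ α h → φ c₁ H²₂.≈ c₂
  φ-first≈second c₁ c₂ d ξ α h c₁≈d (z , w , ξ≈) c₂≈ζ = H²₂.trans {φ c₁} {φ d′} {c₂}
    (φ-cong {c₁} {d′} (H²₁.trans {c₁} {d} {d′} c₁≈d
      (H²₁.sym {d′} {d} (H²₁-intro d′ d z w ξ≈))))
    (H²₂.trans {φ d′} {ζ-class ξ α h} {c₂} (φ≈ζ-class d′ α h)
      (H²₂.sym {c₂} {ζ-class ξ α h} c₂≈ζ))
    where d′ = H²₁-class ξ α h

-- Valuations, residues and ring homomorphisms on units.

module _ {c ℓ₁ ℓ₂ : Level} (V : DiscretelyValuedField c ℓ₁ ℓ₂) where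
  open DiscretelyValuedField V
  open Power Kˣ
  private
    module Kˣ = AbelianGroup Kˣ
    module kˣ = AbelianGroup kˣ
    module v = GroupMorphisms.IsGroupHomomorphism v-homo

  v-^ : ∀ x n → v (x ^ n) ≡ + n ℤ.* v x
  v-^ x zero    = v.ε-homo
  v-^ x (suc n) = ≡.trans (v.homo x (x ^ n))
    (≡.trans (≡.cong (λ i → v x ℤ.+ i) (v-^ x n)) (≡.sym (ℤ.suc-* (+ n) (v x))))

  -- The integers are torsion-free.
  v-root : ∀ x n .{{_ : NonZero n}} → v (x ^ n) ≡ 0ℤ → v x ≡ 0ℤ
  v-root x n@(suc _) h with inj₂ vx≡0 ← ℤ.i*j≡0⇒i≡0∨j≡0 (+ n) (≡.trans (≡.sym (v-^ x n)) h) = vx≡0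

  v-∙⁻¹ : ∀ x y {i} → v x ≡ i → v y ≡ i → v (x Kˣ.∙ y Kˣ.⁻¹) ≡ 0ℤ
  v-∙⁻¹ x y {i} vx≡i vy≡i = ≡.trans (v.homo x (y Kˣ.⁻¹))
    (≡.trans (≡.cong₂ ℤ._+_ vx≡i (≡.trans (v.⁻¹-homo y) (≡.cong ℤ.-_ vy≡i))) (ℤ.+-inverseʳ i))

  residue : ∀ x → v x ≡ 0ℤ → kˣ.Carrier
  residue x@(x₀ , x₁ , l , r) vx≡0 =
    (x₀ , λ u → ℤ.≤-reflexive (≡.sym (≡.trans (v.⟦⟧-cong refl) vx≡0))) ,
    (x₁ , λ u → ℤ.≤-reflexive (≡.sym (≡.trans (v.⟦⟧-cong refl)
      (≡.trans (v.⁻¹-homo x) (≡.cong ℤ.-_ vx≡0))))) ,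
    ≈⇒∈𝔪 l , ≈⇒∈𝔪 r

  residue-^ : ∀ x n (h : v x ≡ 0ℤ) (h′ : v (x ^ n) ≡ 0ℤ) →
              residue (x ^ n) h′ kˣ.≈ Power._^_ kˣ (residue x h) n
  residue-^ x zero    h h′ = kˣ.refl {kˣ.ε}
  residue-^ x (suc n) h h′ = kˣ.trans
    {residue (x ^ suc n) h′} {residue x h kˣ.∙ residue (x ^ n) h″} {residue x h kˣ.∙ Power._^_ kˣ (residue x h) n}
    (≈⇒∈𝔪 refl) (kˣ.∙-congˡ {residue x h} {residue (x ^ n) h″} {Power._^_ kˣ (residue x h) n} (residue-^ x n h h″))
    where
    h″ : v (x ^ n) ≡ 0ℤ
    h″ = ≡.trans (v-^ x n) (≡.trans (≡.cong (+ n ℤ.*_) h) (ℤ.*-zeroʳ (+ n)))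

module _ {c ℓ c′ ℓ′ : Level} (R : CommutativeRing c ℓ) (S : CommutativeRing c′ ℓ′)
  {h : CommutativeRing.Carrier R → CommutativeRing.Carrier S}
  (hom : RingMorphisms.IsRingHomomorphism (CommutativeRing.rawRing R) (CommutativeRing.rawRing S) h)
  where
  open RingMorphisms.IsRingHomomorphism hom
  open CommutativeRing S

  units-map-^ : ∀ x n → h (proj₁ (Power._^_ (units R) x n)) ≈
                        proj₁ (Power._^_ (units S) (units-map R S hom x) n)
  units-map-^ x zero    = 1#-homo
  units-map-^ x (suc n) = trans (*-homo _ _) (*-congˡ (units-map-^ x n))

  units-map-torsion : ∀ x n →
    AbelianGroup._≈_ (units R) (Power._^_ (units R) x n) (AbelianGroup.ε (units R)) →
    AbelianGroup._≈_ (units S) (Power._^_ (units S) (units-map R S hom x) n) (AbelianGroup.ε (units S))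
  units-map-torsion x n x^n≈1 = trans (sym (units-map-^ x n)) (trans (⟦⟧-cong x^n≈1) 1#-homo)

-- Teichmüller lifts and the presentations of a ramified line.

module _ {a b c a′ b′ c′ : Level} {K : LocalField a b c} (e : ℕ) .{{_ : NonZero e}} {f : ℕ}
  (Kf : UnramifiedExtension K f a′ b′ c′) where
  open UnramifiedExtension Kf
  private
    module K = LocalField K
    module L = LocalField L
    module Kˣ = AbelianGroup K.Kˣ
    module Lˣ = AbelianGroup L.Kˣ
    module kˣ = AbelianGroup L.kˣ
    open Power L.Kˣ using () renaming (_^_ to _^ᴸ_)
    open Power L.kˣ using () renaming (_^_ to _^ᵏ_)
    module FL = FiniteField L.residueRing L.residue-1≉0 L.residue-0-or-unit
    q = K.card

    residue-finite : Inverse L.k.setoid (≡.setoid (Fin (q ℕ.^ f)))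
    residue-finite = degree-Inverse (ῑ-homo Kf) residue-degree K.residue-finite

  residue-torsion⇒power : ∀ d n → d ℕ.* n ≡ q ℕ.^ f ∸ 1 →
    ∀ x → (x ^ᵏ d) kˣ.≈ kˣ.ε → ∃ λ u → x kˣ.≈ (u ^ᵏ n)
  residue-torsion⇒power = FL.torsion⇒power residue-finite

  -- The lift is an N-th root of unity with N nonzero.
  v-Teichmüller : ∀ ξ t → IsTeichmüller Kf e ξ t → L.v t ≡ 0ℤ
  v-Teichmüller ξ t (_ , t^≈1) = v-root L.discretelyValuedField t (q ℕ.^ f ∸ 1)
    {{ℕ.≢-nonZero (FL.card∸1≢0 residue-finite)}}
    (≡.trans (v.⟦⟧-cong {t ^ᴸ (q ℕ.^ f ∸ 1)} {Lˣ.ε} t^≈1) v.ε-homo)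
    where module v = GroupMorphisms.IsGroupHomomorphism L.v-homo

  -- The residue lies in k, so it is killed by q - 1, and (q - 1) g = N. As the g-th power map is
  -- the norm, this is the surjectivity of the norm from k_fˣ to kˣ.
  base-residue-power : ∀ κ (h : K.v κ ≡ 0ℤ) (h′ : L.v (ιˣ κ) ≡ 0ℤ) →
    ∃ λ u → residue L.discretelyValuedField (ιˣ κ) h′ kˣ.≈ (u ^ᵏ geom q f)
  base-residue-power κ h h′ = residue-torsion⇒power (q ∸ 1) (geom q f)
    (≡.trans (ℕ.*-comm (q ∸ 1) (geom q f)) (geom-∸1 q f {{K.card-nonZero}}))
    (units-map K.residueRing L.residueRing (ῑ-homo Kf) κ̄)
    (units-map-torsion K.residueRing L.residueRing (ῑ-homo Kf) κ̄ (q ∸ 1) κ̄^≈1)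
    where
    κ̄ = residue K.discretelyValuedField κ h
    κ̄^≈1 = Fermat.unit-exponent K.residueRing K.residue-1≉0 K.residue-0-or-unit K.residue-finite κ̄

  module _ {p} {D : RamifiedLine Kf e p} where
    open RamifiedLine D

    module _ (P : Presentation Kf e D) where
      open Presentation P

      generator : Lˣ.Carrier
      generator = ξ̃ Lˣ.∙ ιˣ π

      generator-mem : Mem generator
      generator-mem = Equivalence.from (generates generator)
        (1ℤ , AbelianGroup.sym (Lˣ/e Kf e) {generator Lˣ.∙ Lˣ.ε} {generator}
          (AbelianGroup.identityʳ (Lˣ/e Kf e) generator))

      v-generator : L.v generator ≡ 1ℤ
      v-generator = ≡.trans (GroupMorphisms.IsGroupHomomorphism.homo L.v-homo ξ̃ (ιˣ π))
        (≡.cong₂ ℤ._+_ (v-Teichmüller ξ ξ̃ ξ̃-lift) (≡.trans (v-extends π) π-unif))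

    -- The valuation is injective on D, so the two generators ξ̃π and ξ̃′π′, both of
    -- valuation 1, agree modulo e-th powers.
    presentations-agree : ∀ (P P′ : Presentation Kf e D) →
      ∃ λ z → ∃ λ w → Presentation.ξ P′ kˣ.≈
        (((z ^ᵏ geom q f) kˣ.∙ (w ^ᵏ e)) kˣ.∙ Presentation.ξ P)
    presentations-agree P P′ = z , w̄ , (begin
      P′.ξ                                       ≈⟨ proj₁ P′.ξ̃-lift ⟨
      red P′.ξ̃ v-ξ̃′                            ≈⟨ L.≈⇒∈𝔪 ξ̃′≈ ⟩
      (red (ιˣ κ) v-ικ kˣ.∙ red (w ^ᴸ e) v-w^) kˣ.∙ red P.ξ̃ v-ξ̃
        ≈⟨ kˣ.∙-cong {red (ιˣ κ) v-ικ kˣ.∙ red (w ^ᴸ e) v-w^} {(z ^ᵏ geom q f) kˣ.∙ (w̄ ^ᵏ e)} {red P.ξ̃ v-ξ̃} {P.ξ}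
          (kˣ.∙-cong {red (ιˣ κ) v-ικ} {z ^ᵏ geom q f} {red (w ^ᴸ e) v-w^} {w̄ ^ᵏ e}
            (proj₂ κ̄-power) (residue-^ L.discretelyValuedField w e v-w v-w^))
          (proj₁ P.ξ̃-lift) ⟩
      ((z ^ᵏ geom q f) kˣ.∙ (w̄ ^ᵏ e)) kˣ.∙ P.ξ  ∎)
      where
      module P = Presentation P
      module P′ = Presentation P′
      module ι = RingMorphisms.IsRingHomomorphism ι-homo
      open SetoidReasoning kˣ.setoid
      red = residue L.discretelyValuedField
      y = generator P
      y′ = generator P′
      agree = GroupMorphisms.IsGroupIsomorphism.injective v-iso
        {y′ , generator-mem P′} {y , generator-mem P}
        (AbelianGroup.reflexive (ℤ/ e ℤ) (≡.trans (v-generator P′) (≡.sym (v-generator P))))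
      w = proj₁ agree
      κ = P.π Kˣ.∙ P′.π Kˣ.⁻¹
      v-κ : K.v κ ≡ 0ℤ
      v-κ = v-∙⁻¹ K.discretelyValuedField P.π P′.π P.π-unif P′.π-unif
      v-ικ = ≡.trans (v-extends κ) v-κ
      v-ξ̃ = v-Teichmüller P.ξ P.ξ̃ P.ξ̃-lift
      v-ξ̃′ = v-Teichmüller P′.ξ P′.ξ̃ P′.ξ̃-lift
      -- To have a residue in k_fˣ, `w` must have valuation 0; its e-th power is a quotient of two
      -- elements of valuation 1, and e is nonzero.
      v-w^ : L.v (w ^ᴸ e) ≡ 0ℤ
      v-w^ = ≡.trans (GroupMorphisms.IsGroupHomomorphism.⟦⟧-cong L.v-homo
          {w ^ᴸ e} {y′ Lˣ.∙ y Lˣ.⁻¹} (L.sym (proj₂ agree)))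
        (v-∙⁻¹ L.discretelyValuedField y′ y (v-generator P′) (v-generator P))
      v-w = v-root L.discretelyValuedField w e v-w^
      w̄ = red w v-w
      κ̄-power = base-residue-power κ v-κ v-ικ
      z = proj₁ κ̄-power
      -- This equation in the big field is y′ / y = w^e solved for ξ̃′; every factor has valuation
      -- 0, so it reduces factor by factor.
      ξ̃′≈ : P′.ξ̃ Lˣ.≈ (ιˣ κ Lˣ.∙ w ^ᴸ e) Lˣ.∙ P.ξ̃
      ξ̃′≈ = L.trans
        (cross-divide L.Kˣ {P′.ξ̃} {ιˣ P′.π} {P.ξ̃} {ιˣ P.π} {w ^ᴸ e} (proj₂ agree))
        (L.*-congʳ (L.*-congʳ (L.sym (ι.*-homo _ _))))

-- The theorem, with the unit group of the residue field as A.

open import Data.Nat.Base using (_^_)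

proposition4p5p1 :
  ∀ {a b c a′ b′ c′ ℓ : Level}
  (K : LocalField a b c)
  (p : ℕ) → HasCharacteristic (LocalField.residueRing K) p →
  (e : ℕ) .{{_ : NonZero e}} → ¬ (p ∣ e) →
  (f : ℕ) .{{_ : NonZero f}} (e∣q^f-1 : e ∣ LocalField.card K ^ f ∸ 1) →
  (Kf : UnramifiedExtension K f a′ b′ c′) →
  let q    = LocalField.card K
      k_fˣ = LocalField.kˣ (UnramifiedExtension.L Kf)
      H²₁  = H² q f (k_fˣ /^ e)
      H²₂  = H² q f (k_fˣ [ e ])
      φ    = H²-map Kf e e∣q^f-1
  in
  GroupMorphisms.IsGroupIsomorphism (AbelianGroup.rawGroup H²₁) (AbelianGroup.rawGroup H²₂) φ
  × ((D : RamifiedLine Kf e ℓ) → GaloisStable Kf e D →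
     ∀ c₁ c₂ → IsFirstClass Kf e D c₁ → IsSecondClass Kf e e∣q^f-1 D c₂ →
     AbelianGroup._≈_ H²₂ (φ c₁) c₂)
proposition4p5p1 K _ _ e _ f e∣ Kf =
    -- The fields are given one by one because comparing whole copies of the groups
    -- H² definitionally, with the proofs that their elements carry, is very slow.
    record
      { isGroupMonomorphism = record
        { isGroupHomomorphism = record
          { isMonoidHomomorphism = record
            { isMagmaHomomorphism = record
              { isRelHomomorphism = record { cong = λ {c} {c′} → φ-cong {c} {c′} }
              ; homo = φ-homo }
            ; ε-homo = φ-ε }
          ; ⁻¹-homo = φ-⁻¹ }
        ; injective = λ {c} {c′} → φ-injective {c} {c′} }
      ; surjective = φ-surjective }
  , λ _ _ c₁ c₂ (P₁ , h₁ , c₁≈) (P₂ , α , h₂ , c₂≈) →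
      φ-first≈second c₁ c₂ (Presentation.ξ P₁ , h₁) (Presentation.ξ P₂) α h₂
        c₁≈ (presentations-agree e Kf P₁ P₂) c₂≈
  where
  open CyclicCohomology (LocalField.kˣ (UnramifiedExtension.L Kf)) (LocalField.card K) f e
    {{LocalField.card-nonZero K}} e∣ (residue-unit-exponent Kf) (residue-torsion⇒power e Kf)
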